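{- There is a polynomial-time algorithm that, given a temporal graph $\mathcal{G}$ and a single source vertex $v$, computes a solution of \textsc{ReachFast} with source set $\{v\}$ of minimum value whenever a solution exists. No bound is placed on the number of delays or on the total delay.
   Context: A temporal graph $\mathcal{G}=\langle G,(E_1,\dots,E_{t_{\max}})\rangle$ consists of a static graph $G=(V,E)$ and edge sets $E_i\subseteq E$ with $E=\bigcup_i E_i$. An edge $e$ has label $i$ if $e\in E_i$, and an edge may have several labels. A temporal path from $v_1$ to $v_{m+1}$ is a sequence $(v_jv_{j+1},t_j)_{j=1}^m$ with $v_jv_{j+1}\in E_{t_j}$ and $t_1<\dots<t_m$; its arrival time is $t_m$. The reaching time $\mathrm{reachtime}(v,\mathcal{G})$ is the least $t$ such that $v$ reaches every vertex by a temporal path with arrival time at most $t$ ($v$ reaches itself at time $0$), and it is $\infty$ otherwise. Delaying a label $i$ of an edge by a positive integer $\delta$ replaces it by $i+\delta$; the new label may exceed $t_{\max}$. A solution of \textsc{ReachFast} with source set $S$ is a temporal graph $\mathcal{G}'$ obtained from $\mathcal{G}$ by delaying any number of labels (each by any amount) such that every source reaches every vertex. Its value is $\max_{s\in S}\mathrm{reachtime}(s,\mathcal{G}')$. -}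

module Defs where

open import Data.Bool.Base using (Bool; true; false; T)
open import Data.Fin.Base using (Fin; toℕ)
open import Data.Fin.Subset using (Subset; _∈_)
open import Data.List.Base using (List; []; _∷_; _++_; [_]; concat; length; map; replicate; tabulate)
open import Data.Maybe.Base using (Maybe; just; nothing)
open import Data.Nat.Base using (ℕ; suc; _+_; _*_; _^_; _≤_; _<_)
open import Data.Product.Base using (_×_; _,_; Σ-syntax; ∃-syntax)
open import Data.Sum.Base using (_⊎_; inj₁; inj₂)
open import Data.Vec.Base as Vec using (Vec)
open import Function.Bundles using (_⇔_; _↔_)
open import Relation.Binary.PropositionalEquality.Core using (_≡_)
open import Relation.Nullary.Negation.Core using (¬_)

record Graph (n : ℕ) : Set where
  field
    adj    : Fin n → Fin n → Bool
    symm   : ∀ u w → adj u w ≡ adj w u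
    irrefl : ∀ u → ¬ T (adj u u)

  Edge : Fin n → Fin n → Set
  Edge u w = T (adj u w)

record TemporalGraph (n : ℕ) : Set where
  field
    static   : Graph n
    tmax     : ℕ
    snapshot : Fin tmax → Graph n
    union    : ∀ u w → Graph.Edge static u w ⇔ (∃[ i ] Graph.Edge (snapshot i) u w)

-- Labels are 1, …, tmax, so `snapshot i` is the edge set of label 1 + i.
HasLabel : ∀ {n} → TemporalGraph n → Fin n → Fin n → ℕ → Set
HasLabel G u w t = ∃[ i ] (t ≡ suc (toℕ i) × Graph.Edge (snapshot i) u w)
  where open TemporalGraph G

-- `TemporalPath G s w t`: a temporal path from s to w with arrival time t.
-- The empty path arrives at time 0, which is smaller than every label.
data TemporalPath {n} (G : TemporalGraph n) (s : Fin n) : Fin n → ℕ → Set where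
  empty  : TemporalPath G s s 0
  extend : ∀ {u w t t′} → TemporalPath G s u t → HasLabel G u w t′ → t < t′ →
           TemporalPath G s w t′

ReachesAllBy : ∀ {n} → TemporalGraph n → Fin n → ℕ → Set
ReachesAllBy G s t = ∀ w → ∃[ t′ ] (t′ ≤ t × TemporalPath G s w t′)

-- The reaching time as a relation; it is ∞ when no t satisfies it.
IsReachtime : ∀ {n} → TemporalGraph n → Fin n → ℕ → Set
IsReachtime G s t = ReachesAllBy G s t × (∀ t′ → ReachesAllBy G s t′ → t ≤ t′)

-- The label i of the edge uw is replaced by i + δ u w i; δ u w i = 0 means
-- that this label is not delayed.  Labels of an edge form a set, so labels
-- moved to the same time coincide.
IsDelayingOf : ∀ {n} → TemporalGraph n → TemporalGraph n → Set
IsDelayingOf {n} G G′ =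
  Σ[ δ ∈ (Fin n → Fin n → ℕ → ℕ) ]
    (∀ u w i → δ u w i ≡ δ w u i) ×
    (∀ u w j → HasLabel G′ u w j ⇔ (∃[ i ] (HasLabel G u w i × j ≡ i + δ u w i)))

IsSolution : ∀ {n} → TemporalGraph n → Subset n → TemporalGraph n → Set
IsSolution G S G′ =
  IsDelayingOf G G′ × (∀ s → s ∈ S → ∀ w → ∃[ t ] TemporalPath G′ s w t)

-- k = max { reachtime(s, G′) | s ∈ S }
IsValue : ∀ {n} → Subset n → TemporalGraph n → ℕ → Set
IsValue S G′ k =
  (∀ s → s ∈ S → ∃[ r ] (IsReachtime G′ s r × r ≤ k)) ×
  (∃[ s ] (s ∈ S × IsReachtime G′ s k))

IsOptimalSolution : ∀ {n} → TemporalGraph n → Subset n → TemporalGraph n → Set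
IsOptimalSolution G S G′ =
  IsSolution G S G′ ×
  (∃[ k ] (IsValue S G′ k ×
           (∀ G″ k″ → IsSolution G S G″ → IsValue S G″ k″ → k ≤ k″)))

-- A temporal graph is written as the sequence of its
-- snapshots (each a row-major adjacency matrix preceded by a 1, with a final
-- 0), so its length is polynomially related to n + tmax + Σ |Eᵢ|.  The static
-- edge set is the union of the snapshots and is not repeated.

unary : ℕ → List Bool
unary k = replicate k true ++ [ false ]

encodeMatrix : ∀ {n} → Graph n → List Bool
encodeMatrix g = concat (tabulate λ u → tabulate λ w → Graph.adj g u w)

encodeSnapshots : ∀ {n} → TemporalGraph n → List Bool
encodeSnapshots G = concat (tabulate λ i → true ∷ encodeMatrix (snapshot i)) ++ [ false ]
  where open TemporalGraph G

encodeGraph : ∀ {n} → TemporalGraph n → List Bool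
encodeGraph {n} G = unary n ++ encodeSnapshots G

encodeInstance : ∀ {n} → TemporalGraph n → Fin n → List Bool
encodeInstance {n} G v = unary n ++ unary (toℕ v) ++ encodeSnapshots G

data Move : Set where
  left stay right : Move

-- The cells left of the head are listed nearest first; all cells beyond the
-- two lists are blank.
record Tape (Γ : Set) : Set where
  constructor tape
  field
    before : List Γ
    head   : Γ
    after  : List Γ

-- Tape symbols: blank (`nothing`), the two bits, and `a` auxiliary symbols.
Symbol : ℕ → Set
Symbol a = Maybe (Bool ⊎ Fin a)

module _ {a : ℕ} where

  moveHead : Move → Tape (Symbol a) → Tape (Symbol a)
  moveHead stay  t                    = t
  moveHead left  (tape []       x rs) = tape [] nothing (x ∷ rs)
  moveHead left  (tape (l ∷ ls) x rs) = tape ls l (x ∷ rs)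
  moveHead right (tape ls x [])       = tape (x ∷ ls) nothing []
  moveHead right (tape ls x (r ∷ rs)) = tape (x ∷ ls) r rs

  act : Symbol a × Move → Tape (Symbol a) → Tape (Symbol a)
  act (y , m) (tape ls _ rs) = moveHead m (tape ls y rs)

  blankTape : Tape (Symbol a)
  blankTape = tape [] nothing []

  inputTape : List Bool → Tape (Symbol a)
  inputTape []       = blankTape
  inputTape (b ∷ bs) = tape [] (just (inj₁ b)) (map (λ c → just (inj₁ c)) bs)

  leadingBits : List (Symbol a) → List Bool
  leadingBits (just (inj₁ b) ∷ xs) = b ∷ leadingBits xs
  leadingBits _                    = []

  -- The bits from the head position up to the first cell not holding a bit.
  readOutput : Tape (Symbol a) → List Bool
  readOutput (tape _ x rs) = leadingBits (x ∷ rs)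

-- Deterministic, multitape: the first tape holds the input, the second the output; the remaining
-- `work` tapes start blank, as does the output tape.  The machine halts when
-- δ returns `nothing`.
record TuringMachine : Set₁ where
  field
    State  : Set
    states : ℕ
    finite : State ↔ Fin states
    start  : State
    aux    : ℕ
    work   : ℕ
    δ      : State → Vec (Symbol aux) (2 + work) →
             Maybe (State × Vec (Symbol aux × Move) (2 + work))

  Config : Set
  Config = State × Vec (Tape (Symbol aux)) (2 + work)

  step : Config → Maybe Config
  step (q , ts) with δ q (Vec.map Tape.head ts)
  ... | nothing          = nothing
  ... | just (q′ , acts) = just (q′ , Vec.zipWith act acts ts)

  initial : List Bool → Config
  initial x = start , inputTape x Vec.∷ Vec.replicate (1 + work) blankTape

  outputOf : Config → List Bool
  outputOf (_ , _ Vec.∷ out Vec.∷ _) = readOutput out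

  data _⇓[_]_ : Config → ℕ → Config → Set where
    halted : ∀ {c} → step c ≡ nothing → c ⇓[ 0 ] c
    next   : ∀ {c c′ c″ t} → step c ≡ just c′ → c′ ⇓[ t ] c″ → c ⇓[ suc t ] c″

  Computes[_] : ℕ → List Bool → List Bool → Set
  Computes[ t ] x y = ∃[ c ] ((initial x ⇓[ t ] c) × outputOf c ≡ y)

-- M halts on every input `enc i` within C · |enc i| ^ d + C steps, and its
-- output is related to i by R.
PolyTimeSolves : TuringMachine → {I : Set} → (I → List Bool) → (I → List Bool → Set) → Set
PolyTimeSolves M {I} enc R =
  ∃[ C ] ∃[ d ] ∀ (i : I) → ∃[ t ] ∃[ y ]
    (TuringMachine.Computes[_] M t (enc i) y ×
     t ≤ C * length (enc i) ^ d + C ×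
     R i y)

Instance : Set
Instance = Σ[ n ∈ ℕ ] (TemporalGraph n × Fin n)

{-# OPTIONS --safe #-}

-- Let a(v) = 0 and let a(w) be the minimum over the neighbours u of w of
-- max (least label of uw, a(u) + 1).  By induction along temporal paths, no
-- delaying of G lets v reach w before time a(w).  Conversely, moving every
-- label i of uw to max (i, min (a(u), a(w)) + 1) makes v reach every w at
-- time a(w) exactly.
--
-- This delaying is produced in one sweep over time: keep the set R of vertices
-- reached so far and the set P of edges with a label held back.  In round t
-- every edge of E_t ∪ P that touches R is released with label t and its
-- endpoints enter R; the other edges of E_t ∪ P are held.  If a solution
-- exists, each round after the last snapshot reaches a new vertex until all are
-- reached, so n further rounds release everything.  A round is a single pass over the n × n adjacency matrix.

module Submission where

open import Data.Bool.Base using (Bool; true; false; _∧_; _∨_; not; T; if_then_else_)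
open import Data.Bool.Properties using (T?; T-∧; T-∨; T-≡; ∨-comm)
open import Data.Empty using (⊥-elim)
open import Data.Fin.Base using (Fin; zero; suc; toℕ; fromℕ<)
open import Data.Fin.Properties using (all?; ¬∀⟶∃¬; toℕ<n; toℕ-fromℕ<) renaming (_≟_ to _≟ᶠ_)
open import Data.Fin.Subset using (Subset; _∈_; ∣_∣; ⁅_⁆)
open import Data.Fin.Subset.Properties using (∣p∣≤n; ∣p∣≡n⇒p≡⊤; p⊂q⇒∣p∣<∣q∣; x∈p⇒∣p-x∣<∣p∣; ∈⊤; x∈⁅x⁆; x∈⁅y⁆⇒x≡y)
open import Data.List.Base using (List; []; _∷_; _++_; [_]; concat; length; map; replicate; tabulate; reverse; _ʳ++_)
open import Data.List.Properties
open import Data.Maybe.Base using (Maybe; just; nothing)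
open import Data.Nat.Base using (ℕ; zero; suc; pred; >-nonZero; _+_; _*_; _^_; _∸_; _≤_; _<_; z≤n; s≤s)
open import Data.Nat.Properties
open import Data.Nat.Solver using (module +-*-Solver)
open import Data.Product.Base using (_×_; _,_; proj₁; proj₂; Σ-syntax; ∃-syntax)
open import Data.Sum.Base using (_⊎_; inj₁; inj₂; [_,_]′)
open import Data.Vec.Base as Vec using (Vec; []; _∷_)
open import Data.Vec.Properties using (lookup⇒[]=; []=⇒lookup; lookup∘tabulate)
open import Function.Base using (_∘_)
open import Function.Bundles using (_↔_; mk↔ₛ′; mk⇔; Equivalence)
open import Relation.Binary.PropositionalEquality hiding ([_])
open import Relation.Nullary.Decidable using (yes; no; ⌊_⌋; toWitness; fromWitness)
open import Relation.Nullary.Negation using (¬_; contradiction)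
open import Defs

-- The sweep on Boolean matrices

Matrix : ℕ → Set
Matrix n = Fin n → Fin n → Bool

private variable
  m n k : ℕ

-- e is a snapshot and p the held edges; r and c are both the reached set, which
-- rows and columns index separately so that one can recurse on the rows alone.
released held : (Fin m → Fin n → Bool) → (Fin m → Fin n → Bool) → (Fin m → Bool) → (Fin n → Bool) →
                Fin m → Fin n → Bool
released e p r c u w = (e u w ∨ p u w) ∧ (r u ∨ c w)
held     e p r c u w = (e u w ∨ p u w) ∧ not (r u ∨ c w)

-- The argument `z` accumulates the new set row by row, in the order in which the machine scans the
-- matrix. An edge is followed only from its row vertex; the other direction comes from the
-- symmetric entry.
reached : (Fin m → Fin n → Bool) → (Fin m → Fin n → Bool) → (Fin m → Bool) → (Fin n → Bool) → Fin n → Bool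
reached {zero}  e p r z = z
reached {suc m} e p r z =
  reached (e ∘ suc) (p ∘ suc) (r ∘ suc) (λ w → z w ∨ ((e zero w ∨ p zero w) ∧ r zero))

-- The machine

-- The first three states read `n` and the source. A round leaves `header`, runs `scan`, `nextRow`
-- and `rewindRow` over the rows, then `commit` copies the new reached set over both old copies and
-- `rewindP` returns to the start of the held matrix. Initialisation also passes through `commit`,
-- which spreads the source bit.
data State : Set where
  setUp copy locate commit rewindP header scan nextRow rewindRow rewindOutput done : State

State↔Fin : State ↔ Fin 11
State↔Fin = mk↔ₛ′ to from (toWitness {a? = all? λ i → to (from i) ≟ᶠ i} _) from∘to
  where
  from : Fin 11 → State
  from = Vec.lookup (setUp ∷ copy ∷ locate ∷ commit ∷ rewindP ∷ header ∷ scan ∷ nextRow ∷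
                     rewindRow ∷ rewindOutput ∷ done ∷ [])
  to : State → Fin 11
  to setUp        = zero
  to copy         = suc zero
  to locate       = suc (suc zero)
  to commit       = suc (suc (suc zero))
  to rewindP      = suc (suc (suc (suc zero)))
  to header       = suc (suc (suc (suc (suc zero))))
  to scan         = suc (suc (suc (suc (suc (suc zero)))))
  to nextRow      = suc (suc (suc (suc (suc (suc (suc zero))))))
  to rewindRow    = suc (suc (suc (suc (suc (suc (suc (suc zero)))))))
  to rewindOutput = suc (suc (suc (suc (suc (suc (suc (suc (suc zero))))))))
  to done         = suc (suc (suc (suc (suc (suc (suc (suc (suc (suc zero)))))))))
  from∘to : ∀ s → from (to s) ≡ s
  from∘to setUp        = refl
  from∘to copy         = refl
  from∘to locate       = refl
  from∘to commit       = refl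
  from∘to rewindP      = refl
  from∘to header       = refl
  from∘to scan         = refl
  from∘to nextRow      = refl
  from∘to rewindRow    = refl
  from∘to rewindOutput = refl
  from∘to done         = refl

Sym : Set
Sym = Symbol 0

bit : Bool → Sym
bit b = just (inj₁ b)

bitOf : Sym → Bool
bitOf (just (inj₁ b)) = b
bitOf _               = false

Action : Set
Action = Maybe (State × Vec (Sym × Move) 7)

-- A round without a snapshot costs one mark of the counter, and a blank counter closes the output
-- with `false`. Every round first writes `true`, so the output has the format of an encoded
-- snapshot sequence.
enterRound : Bool → Vec Sym 7 → Action
enterRound true (i ∷ o ∷ k ∷ p ∷ x ∷ y ∷ z ∷ []) =
  just (scan , (i , right) ∷ (bit true , right) ∷ (k , stay) ∷ (p , stay) ∷ (x , stay) ∷ (y , stay) ∷ (z , stay) ∷ [])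
enterRound false (i ∷ o ∷ just k ∷ p ∷ x ∷ y ∷ z ∷ []) =
  just (scan , (i , right) ∷ (bit true , right) ∷ (just k , left) ∷ (p , stay) ∷ (x , stay) ∷ (y , stay) ∷ (z , stay) ∷ [])
enterRound false (i ∷ o ∷ nothing ∷ p ∷ x ∷ y ∷ z ∷ []) =
  just (rewindOutput , (i , stay) ∷ (bit false , left) ∷ (nothing , stay) ∷ (p , stay) ∷ (x , stay) ∷ (y , stay) ∷ (z , stay) ∷ [])

scanCell : (e p x y z : Bool) → Vec (Sym × Move) 7 → Vec (Sym × Move) 7
scanCell e p x y z (_ ∷ _ ∷ k ∷ _ ∷ x′ ∷ _ ∷ _ ∷ []) =
  (bit e , right) ∷ (bit ((e ∨ p) ∧ (x ∨ y)) , right) ∷ k ∷ (bit ((e ∨ p) ∧ not (x ∨ y)) , right) ∷ x′ ∷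
  (bit y , right) ∷ (bit (z ∨ ((e ∨ p) ∧ x)) , right) ∷ []

-- Tapes: input, output, a unary counter of the rounds after the input is
-- exhausted, the held matrix, the reached set indexed by rows and by columns,
-- and the reached set of the next round.
transition : State → Vec Sym 7 → Action
transition setUp (i ∷ o ∷ k ∷ p ∷ x ∷ y ∷ z ∷ []) =
  just (copy , (i , stay) ∷ (o , stay) ∷ (k , stay) ∷ (p , right) ∷ (x , left) ∷ (y , left) ∷ (z , left) ∷ [])
transition copy (just (inj₁ true) ∷ o ∷ k ∷ p ∷ x ∷ y ∷ z ∷ []) =
  just (copy , (bit true , right) ∷ (bit true , right) ∷ (bit true , right) ∷ (p , stay) ∷
               (bit false , left) ∷ (bit false , left) ∷ (bit false , left) ∷ [])
transition copy (i ∷ o ∷ k ∷ p ∷ x ∷ y ∷ z ∷ []) =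
  just (locate , (i , right) ∷ (bit false , right) ∷ (k , left) ∷ (p , stay) ∷ (x , right) ∷ (y , right) ∷ (z , right) ∷ [])
transition locate (just (inj₁ true) ∷ o ∷ k ∷ p ∷ x ∷ y ∷ z ∷ []) =
  just (locate , (bit true , right) ∷ (o , stay) ∷ (k , stay) ∷ (p , stay) ∷ (x , right) ∷ (y , right) ∷ (z , right) ∷ [])
transition locate (i ∷ o ∷ k ∷ p ∷ x ∷ y ∷ z ∷ []) =
  just (commit , (i , right) ∷ (o , stay) ∷ (k , stay) ∷ (p , stay) ∷ (x , stay) ∷ (y , stay) ∷ (bit true , stay) ∷ [])
transition commit (i ∷ o ∷ k ∷ p ∷ x ∷ y ∷ just z ∷ []) =
  just (commit , (i , stay) ∷ (o , stay) ∷ (k , stay) ∷ (p , stay) ∷ (just z , left) ∷ (just z , left) ∷ (just z , left) ∷ [])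
transition commit (i ∷ o ∷ k ∷ p ∷ x ∷ y ∷ nothing ∷ []) =
  just (rewindP , (i , stay) ∷ (o , stay) ∷ (k , stay) ∷ (p , left) ∷ (x , right) ∷ (y , right) ∷ (nothing , right) ∷ [])
transition rewindP (i ∷ o ∷ k ∷ just p ∷ x ∷ y ∷ z ∷ []) =
  just (rewindP , (i , stay) ∷ (o , stay) ∷ (k , stay) ∷ (just p , left) ∷ (x , stay) ∷ (y , stay) ∷ (z , stay) ∷ [])
transition rewindP (i ∷ o ∷ k ∷ nothing ∷ x ∷ y ∷ z ∷ []) =
  just (header , (i , stay) ∷ (o , stay) ∷ (k , stay) ∷ (nothing , right) ∷ (x , stay) ∷ (y , stay) ∷ (z , stay) ∷ [])
transition header (i ∷ v) = enterRound (bitOf i) (i ∷ v)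
transition scan (i ∷ o ∷ k ∷ p ∷ x ∷ just y ∷ z ∷ []) =
  just (scan , scanCell (bitOf i) (bitOf p) (bitOf x) (bitOf (just y)) (bitOf z)
                 (Vec.map (_, stay) (i ∷ o ∷ k ∷ p ∷ x ∷ just y ∷ z ∷ [])))
transition scan (i ∷ o ∷ k ∷ p ∷ x ∷ nothing ∷ z ∷ []) =
  just (nextRow , (i , stay) ∷ (o , stay) ∷ (k , stay) ∷ (p , stay) ∷ (x , right) ∷ (nothing , stay) ∷ (z , stay) ∷ [])
transition nextRow (i ∷ o ∷ k ∷ p ∷ just x ∷ y ∷ z ∷ []) =
  just (rewindRow , (i , stay) ∷ (o , stay) ∷ (k , stay) ∷ (p , stay) ∷ (just x , stay) ∷ (y , left) ∷ (z , left) ∷ [])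
transition nextRow (i ∷ o ∷ k ∷ p ∷ nothing ∷ y ∷ z ∷ []) =
  just (commit , (i , stay) ∷ (o , stay) ∷ (k , stay) ∷ (p , stay) ∷ (nothing , left) ∷ (y , left) ∷ (z , left) ∷ [])
transition rewindRow (i ∷ o ∷ k ∷ p ∷ x ∷ just y ∷ z ∷ []) =
  just (rewindRow , (i , stay) ∷ (o , stay) ∷ (k , stay) ∷ (p , stay) ∷ (x , stay) ∷ (just y , left) ∷ (z , left) ∷ [])
transition rewindRow (i ∷ o ∷ k ∷ p ∷ x ∷ nothing ∷ z ∷ []) =
  just (scan , (i , stay) ∷ (o , stay) ∷ (k , stay) ∷ (p , stay) ∷ (x , stay) ∷ (nothing , right) ∷ (z , right) ∷ [])
transition rewindOutput (i ∷ just o ∷ v) =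
  just (rewindOutput , (i , stay) ∷ (just o , left) ∷ Vec.map (_, stay) v)
transition rewindOutput (i ∷ nothing ∷ v) =
  just (done , (i , stay) ∷ (nothing , right) ∷ Vec.map (_, stay) v)
transition done _ = nothing

machine : TuringMachine
machine = record
  { State = State ; states = 11 ; finite = State↔Fin ; start = setUp
  ; aux = 0 ; work = 5 ; δ = transition }

open TuringMachine machine using (Config; step; initial; outputOf; _⇓[_]_; halted; next; Computes[_])

-- Runs of the machine and contents of its tapes

infixr 5 _∷_ _▷_
infix 4 _⟶[_]_

data _⟶[_]_ : Config → ℕ → Config → Set where
  []  : ∀ {c} → c ⟶[ 0 ] c
  _∷_ : ∀ {c c′ c″ t} → step c ≡ just c′ → c′ ⟶[ t ] c″ → c ⟶[ suc t ] c″

_▷_ : ∀ {c c′ c″ s t} → c ⟶[ s ] c′ → c′ ⟶[ t ] c″ → c ⟶[ s + t ] c″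
[]       ▷ qs = qs
(p ∷ ps) ▷ qs = p ∷ (ps ▷ qs)

halts : ∀ {c c′ t} → c ⟶[ t ] c′ → step c′ ≡ nothing → c ⇓[ t ] c′
halts []       h = halted h
halts (p ∷ ps) h = next p (halts ps h)

cells : List Bool → List Sym
cells = map λ c → just (inj₁ c)

-- An empty list under the head stands for a blank cell. This hides the case distinction in
-- `moveHead`, which takes the uniform form of `right-load` and `left-loadˡ`.
load loadˡ : List Sym → List Sym → Tape Sym
load ls []       = tape ls nothing []
load ls (r ∷ rs) = tape ls r rs
loadˡ []       rs = tape [] nothing rs
loadˡ (l ∷ ls) rs = tape ls l rs

right-load : ∀ ls x rs → moveHead right (tape ls x rs) ≡ load (x ∷ ls) rs
right-load ls x []       = refl
right-load ls x (r ∷ rs) = refl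

left-loadˡ : ∀ ls x rs → moveHead left (tape ls x rs) ≡ loadˡ ls (x ∷ rs)
left-loadˡ []       x rs = refl
left-loadˡ (l ∷ ls) x rs = refl

-- Blank cells are read as false, so the input may be read beyond its end.
Pass : ∀ {k} → (Fin k → Bool) → (Fin k → Bool) → Tape Sym → Tape Sym → Set
Pass {zero}  r w τ τ′ = τ ≡ τ′
Pass {suc k} r w τ τ′ =
  bitOf (Tape.head τ) ≡ r zero × Pass (r ∘ suc) (w ∘ suc) (act (bit (w zero) , right) τ) τ′

-- The symbols themselves must agree, not just their `bitOf`, because a blank on the column tape
-- ends the row.
Skim : ∀ {k} → (Fin k → Bool) → Tape Sym → Tape Sym → Set
Skim {zero}  r τ τ′ = τ ≡ τ′
Skim {suc k} r τ τ′ = Tape.head τ ≡ bit (r zero) × Skim (r ∘ suc) (moveHead right τ) τ′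

PassRows : (r w : Fin m → Fin n → Bool) → Tape Sym → Tape Sym → Set
PassRows {zero}  r w τ τ′ = τ ≡ τ′
PassRows {suc m} r w τ τ′ =
  ∃[ τ₁ ] (Pass (r zero) (w zero) τ τ₁ × PassRows (r ∘ suc) (w ∘ suc) τ₁ τ′)

rowMajor : (Fin m → Fin n → Bool) → List Bool
rowMajor r = concat (tabulate λ u → tabulate (r u))

pass-cells : ∀ {k} (r w : Fin k → Bool) ls rs →
  Pass r w (load ls (cells (tabulate r) ++ rs)) (load (cells (tabulate w) ʳ++ ls) rs)
pass-cells {zero}  r w ls rs = refl
pass-cells {suc k} r w ls rs =
  refl , subst (λ τ → Pass (r ∘ suc) (w ∘ suc) τ (load (cells (tabulate w) ʳ++ ls) rs)) (sym (right-load ls _ (cells (tabulate (r ∘ suc)) ++ rs)))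
           (pass-cells (r ∘ suc) (w ∘ suc) (bit (w zero) ∷ ls) rs)

pass-blank : ∀ {k} (w : Fin k → Bool) ls →
  Pass (λ _ → false) w (load ls []) (load (cells (tabulate w) ʳ++ ls) [])
pass-blank {zero}  w ls = refl
pass-blank {suc k} w ls = refl , pass-blank (w ∘ suc) (bit (w zero) ∷ ls)

skim-cells : ∀ {k} (r : Fin k → Bool) ls rs →
  Skim r (load ls (cells (tabulate r) ++ rs)) (load (cells (tabulate r) ʳ++ ls) rs)
skim-cells {zero}  r ls rs = refl
skim-cells {suc k} r ls rs =
  refl , subst (λ τ → Skim (r ∘ suc) τ (load (cells (tabulate r) ʳ++ ls) rs)) (sym (right-load ls _ (cells (tabulate (r ∘ suc)) ++ rs)))
           (skim-cells (r ∘ suc) (bit (r zero) ∷ ls) rs)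

cells-++ʳ : ∀ xs ys zs → cells ys ʳ++ (cells xs ʳ++ zs) ≡ cells (xs ++ ys) ʳ++ zs
cells-++ʳ xs ys zs = trans (sym (++-ʳ++ (cells xs))) (cong (_ʳ++ zs) (sym (map-++ _ xs ys)))

cells-++ : ∀ xs ys zs → cells (xs ++ ys) ++ zs ≡ cells xs ++ (cells ys ++ zs)
cells-++ xs ys zs = trans (cong (_++ zs) (map-++ _ xs ys)) (++-assoc (cells xs) (cells ys) zs)

passRows-cells : (r w : Fin m → Fin n → Bool) → ∀ ls rs →
  PassRows r w (load ls (cells (rowMajor r) ++ rs)) (load (cells (rowMajor w) ʳ++ ls) rs)
passRows-cells {zero}  r w ls rs = refl
passRows-cells {suc m} r w ls rs
  rewrite cells-++ (tabulate (r zero)) (rowMajor (r ∘ suc)) rs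
        | sym (cells-++ʳ (tabulate (w zero)) (rowMajor (w ∘ suc)) ls)
  = _ , pass-cells (r zero) (w zero) ls _ , passRows-cells (r ∘ suc) (w ∘ suc) _ rs

passRows-blank : (w : Fin m → Fin n → Bool) → ∀ ls →
  PassRows (λ _ _ → false) w (load ls []) (load (cells (rowMajor w) ʳ++ ls) [])
passRows-blank {zero}  w ls = refl
passRows-blank {suc m} w ls
  rewrite sym (cells-++ʳ (tabulate (w zero)) (rowMajor (w ∘ suc)) ls)
  = _ , pass-blank (w zero) ls , passRows-blank (w ∘ suc) _

-- One round on the machine

scan-row : ∀ {k} (e p y z : Fin k → Bool) a {I I′ O O′ K P P′ lx rx Y Y′ Z Z′} →
  Pass e e I I′ →
  Pass (λ _ → false) (λ w → (e w ∨ p w) ∧ (a ∨ y w)) O O′ →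
  Pass p (λ w → (e w ∨ p w) ∧ not (a ∨ y w)) P P′ →
  Skim y Y Y′ →
  Pass z (λ w → z w ∨ ((e w ∨ p w) ∧ a)) Z Z′ →
  (scan , I  ∷ O  ∷ K ∷ P  ∷ tape lx (bit a) rx ∷ Y  ∷ Z  ∷ []) ⟶[ k ]
  (scan , I′ ∷ O′ ∷ K ∷ P′ ∷ tape lx (bit a) rx ∷ Y′ ∷ Z′ ∷ [])
scan-row {zero} e p y z a refl refl refl refl refl = []
scan-row {suc k} e p y z a {I} {O = O} {K = K} {P} {lx = lx} {rx} {tape ly _ ry} {Z = Z} (i , I↦) (_ , O↦) (j , P↦) (refl , Y↦) (l , Z↦) =
  scan-cell i j l ∷ scan-row (e ∘ suc) (p ∘ suc) (y ∘ suc) (z ∘ suc) a I↦ O↦ P↦ Y↦ Z↦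
  where
  -- Matching the three equations replaces the Booleans by the bits actually read, after which the
  -- step computes.
  scan-cell : ∀ {e p y z} → bitOf (Tape.head I) ≡ e → bitOf (Tape.head P) ≡ p → bitOf (Tape.head Z) ≡ z →
    step (scan , I ∷ O ∷ K ∷ P ∷ tape lx (bit a) rx ∷ tape ly (bit y) ry ∷ Z ∷ []) ≡
    just (scan , act (bit e , right) I ∷ act (bit ((e ∨ p) ∧ (a ∨ y)) , right) O ∷ K ∷
                 act (bit ((e ∨ p) ∧ not (a ∨ y)) , right) P ∷ tape lx (bit a) rx ∷
                 moveHead right (tape ly (bit y) ry) ∷ act (bit (z ∨ ((e ∨ p) ∧ a)) , right) Z ∷ [])
  scan-cell refl refl refl = refl

-- The delimiting blanks are explicit list entries. Tapes that differ only in trailing blanks are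
-- different terms, and with these entries a pass to the end and back restores the same term.
startOf endOf : (Fin k → Bool) → Tape Sym
startOf y = load [ nothing ] (cells (tabulate y) ++ [ nothing ])
endOf   y = tape (cells (tabulate y) ʳ++ [ nothing ]) nothing []

∷⟨_,_⟩_ : ∀ {c c₁ c₂ c₃ t} → step c ≡ just c₁ → c₁ ≡ c₂ → c₂ ⟶[ t ] c₃ → c ⟶[ suc t ] c₃
∷⟨ p , refl ⟩ ps = p ∷ ps

cells-reverse : ∀ xs ys → cells xs ʳ++ ys ≡ cells (reverse xs) ++ ys
cells-reverse xs ys = trans (ʳ++-defn (cells xs)) (cong (_++ ys) (sym (reverse-map _ xs)))

left-end : ∀ xs → moveHead left (tape (cells xs ʳ++ [ nothing ]) nothing []) ≡
                  loadˡ (cells (reverse xs) ++ [ nothing ]) [ nothing ]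
left-end xs = trans (left-loadˡ (cells xs ʳ++ [ nothing ]) nothing [])
                    (cong (λ ls → loadˡ ls [ nothing ]) (cells-reverse xs [ nothing ]))

unreverse : ∀ xs ys → cells (reverse xs) ʳ++ ys ≡ cells xs ++ ys
unreverse xs ys = trans (cells-reverse (reverse xs) ys) (cong (λ zs → cells zs ++ ys) (reverse-involutive xs))

length-reverse-tabulate : (f : Fin k → Bool) → length (reverse (tabulate f)) ≡ k
length-reverse-tabulate f = trans (length-reverse (tabulate f)) (length-tabulate f)

left-cells : ∀ b bs rs → moveHead left (tape (cells bs ++ [ nothing ]) b rs) ≡ loadˡ (cells bs ++ [ nothing ]) (b ∷ rs)
left-cells b bs rs = left-loadˡ (cells bs ++ [ nothing ]) b rs

-- The cells left of the heads are listed nearest first, so the induction peels off the cell under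
-- each head. `rewindRow-run` applies this to the reversed rows.
rewindRow-loop : ∀ {k} as bs → length as ≡ k → length bs ≡ k → ∀ {I O K P X ry rz} →
  (rewindRow , I ∷ O ∷ K ∷ P ∷ X ∷ loadˡ (cells as ++ [ nothing ]) ry ∷ loadˡ (cells bs ++ [ nothing ]) rz ∷ []) ⟶[ k + 1 ]
  (scan , I ∷ O ∷ K ∷ P ∷ X ∷ load [ nothing ] (cells as ʳ++ ry) ∷ load [ nothing ] (cells bs ʳ++ rz) ∷ [])
rewindRow-loop []       []       refl refl {I} {O} {K} {P} {X} {ry} {rz} =
  ∷⟨ refl , cong₂ (λ y z → scan , I ∷ O ∷ K ∷ P ∷ X ∷ y ∷ z ∷ [])
              (right-load [] nothing ry) (right-load [] nothing rz) ⟩ []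
rewindRow-loop (a ∷ as) (b ∷ bs) refl eq {I} {O} {K} {P} {X} {ry} {rz} =
  ∷⟨ refl , cong₂ (λ y z → rewindRow , I ∷ O ∷ K ∷ P ∷ X ∷ y ∷ z ∷ [])
              (left-cells (bit a) as ry) (left-cells (bit b) bs rz) ⟩
  rewindRow-loop as bs refl (suc-injective eq)

rewindRow-run : ∀ {k} (y z : Fin k → Bool) {I O K P X} →
  (rewindRow , I ∷ O ∷ K ∷ P ∷ X ∷ moveHead left (endOf y) ∷ moveHead left (endOf z) ∷ []) ⟶[ k + 1 ]
  (scan , I ∷ O ∷ K ∷ P ∷ X ∷ startOf y ∷ startOf z ∷ [])
rewindRow-run y z
  rewrite left-end (tabulate y) | left-end (tabulate z)
        | sym (unreverse (tabulate y) [ nothing ]) | sym (unreverse (tabulate z) [ nothing ])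
  = rewindRow-loop (reverse (tabulate y)) (reverse (tabulate z)) (length-reverse-tabulate y) (length-reverse-tabulate z)

-- The heads may start anywhere in the row: `commit-run` starts at the right end, `locate-loop` at
-- the cell of the source.
commit-loop : ∀ {k} as bs cs → length as ≡ k → length bs ≡ k → length cs ≡ k → ∀ {I O K P rx ry rz} →
  (commit , I ∷ O ∷ K ∷ P ∷ loadˡ (cells as ++ [ nothing ]) rx ∷ loadˡ (cells bs ++ [ nothing ]) ry ∷
            loadˡ (cells cs ++ [ nothing ]) rz ∷ []) ⟶[ k + 1 ]
  (rewindP , I ∷ O ∷ K ∷ moveHead left P ∷ load [ nothing ] (cells cs ʳ++ rx) ∷ load [ nothing ] (cells cs ʳ++ ry) ∷
             load [ nothing ] (cells cs ʳ++ rz) ∷ [])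
commit-loop [] [] [] refl refl refl {I} {O} {K} {P} {rx} {ry} {rz} =
  ∷⟨ refl , cong (λ v → rewindP , I ∷ O ∷ K ∷ moveHead left P ∷ v)
              (cong₂ _∷_ (right-load [] nothing rx) (cong₂ _∷_ (right-load [] nothing ry)
                (cong (_∷ []) (right-load [] nothing rz)))) ⟩ []
commit-loop (a ∷ as) (b ∷ bs) (c ∷ cs) refl q r {I} {O} {K} {P} {rx} {ry} {rz} =
  ∷⟨ refl , cong (λ v → commit , I ∷ O ∷ K ∷ P ∷ v)
              (cong₂ _∷_ (left-cells (bit c) as rx) (cong₂ _∷_ (left-cells (bit c) bs ry)
                (cong (_∷ []) (left-cells (bit c) cs rz)))) ⟩
  commit-loop as bs cs refl (suc-injective q) (suc-injective r)

commit-run : ∀ {k} (x y z : Fin k → Bool) {I O K P} →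
  (commit , I ∷ O ∷ K ∷ P ∷ moveHead left (endOf x) ∷ moveHead left (endOf y) ∷ moveHead left (endOf z) ∷ []) ⟶[ k + 1 ]
  (rewindP , I ∷ O ∷ K ∷ moveHead left P ∷ startOf z ∷ startOf z ∷ startOf z ∷ [])
commit-run x y z
  rewrite left-end (tabulate x) | left-end (tabulate y) | left-end (tabulate z)
        | sym (unreverse (tabulate z) [ nothing ])
  = commit-loop (reverse (tabulate x)) (reverse (tabulate y)) (reverse (tabulate z))
      (length-reverse-tabulate x) (length-reverse-tabulate y) (length-reverse-tabulate z)

rewindP-loop : ∀ bs {I O K rp X Y Z} →
  (rewindP , I ∷ O ∷ K ∷ loadˡ (cells bs ++ [ nothing ]) rp ∷ X ∷ Y ∷ Z ∷ []) ⟶[ length bs + 1 ]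
  (header , I ∷ O ∷ K ∷ load [ nothing ] (cells bs ʳ++ rp) ∷ X ∷ Y ∷ Z ∷ [])
rewindP-loop [] {I} {O} {K} {rp} {X} {Y} {Z} =
  ∷⟨ refl , cong (λ p → header , I ∷ O ∷ K ∷ p ∷ X ∷ Y ∷ Z ∷ []) (right-load [] nothing rp) ⟩ []
rewindP-loop (b ∷ bs) {I} {O} {K} {rp} {X} {Y} {Z} =
  ∷⟨ refl , cong (λ p → rewindP , I ∷ O ∷ K ∷ p ∷ X ∷ Y ∷ Z ∷ []) (left-cells (bit b) bs rp) ⟩
  rewindP-loop bs

rewindP-run : ∀ {k} bs → length bs ≡ k → ∀ {I O K X Y Z} →
  (rewindP , I ∷ O ∷ K ∷ moveHead left (tape (cells bs ʳ++ [ nothing ]) nothing []) ∷ X ∷ Y ∷ Z ∷ []) ⟶[ k + 1 ]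
  (header , I ∷ O ∷ K ∷ load [ nothing ] (cells bs ++ [ nothing ]) ∷ X ∷ Y ∷ Z ∷ [])
rewindP-run bs refl
  rewrite left-end bs | sym (unreverse bs [ nothing ]) | sym (length-reverse bs)
  = rewindP-loop (reverse bs)

-- This counts `suc k` rows. The last one is separate because it leads to `commit` without rewinding
-- the column tapes.
rowsTime : ℕ → ℕ → ℕ
rowsTime n zero    = n + 2
rowsTime n (suc k) = n + (2 + (n + 1 + rowsTime n k))

-- Between rows `y` is rewound unchanged while `z` is updated exactly as in the recursion of
-- `reached`. Input, output and held matrix enter only through `PassRows`, so the same proof covers
-- real snapshots, an exhausted input and the blank matrix of the first round.
scan-rows : ∀ k (e p : Fin (suc k) → Fin n → Bool) (a : Fin (suc k) → Bool) (y z : Fin n → Bool) {lx I I′ O O′ K P P′} →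
  PassRows e e I I′ →
  PassRows (λ _ _ → false) (released e p a y) O O′ →
  PassRows p (held e p a y) P P′ →
  (scan , I ∷ O ∷ K ∷ P ∷ load lx (cells (tabulate a) ++ [ nothing ]) ∷ startOf y ∷ startOf z ∷ []) ⟶[ rowsTime n k ]
  (commit , I′ ∷ O′ ∷ K ∷ P′ ∷ moveHead left (tape (cells (tabulate a) ʳ++ lx) nothing []) ∷
            moveHead left (endOf y) ∷ moveHead left (endOf (reached e p a z)) ∷ [])
scan-rows zero e p a y z (_ , I↦ , refl) (_ , O↦ , refl) (_ , P↦ , refl) =
  scan-row (e zero) (p zero) y z (a zero) I↦ O↦ P↦
    (skim-cells y [ nothing ] [ nothing ])
    (pass-cells z _ [ nothing ] [ nothing ])
  ▷ refl ∷ refl ∷ []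
scan-rows (suc k) e p a y z (_ , I↦ , I↦′) (_ , O↦ , O↦′) (_ , P↦ , P↦′) =
  scan-row (e zero) (p zero) y z (a zero) I↦ O↦ P↦
    (skim-cells y [ nothing ] [ nothing ])
    (pass-cells z _ [ nothing ] [ nothing ])
  ▷ refl ∷ refl ∷ (rewindRow-run y (λ w → z w ∨ ((e zero w ∨ p zero w) ∧ a zero))
  ▷ scan-rows k (e ∘ suc) (p ∘ suc) (a ∘ suc) y _ I↦′ O↦′ P↦′)

atHeader : Tape Sym → List Bool → Tape Sym → List Sym → (Fin n → Bool) → Config
atHeader I os K ps r = header , I ∷ load (cells os ʳ++ []) [] ∷ K ∷ load [ nothing ] ps ∷ startOf r ∷ startOf r ∷ startOf r ∷ []

-- Scanning, `commit` and `rewindP`. The step out of `header` is not included, whence the later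
-- `suc (roundTime n)` per round.
roundTime : ℕ → ℕ
roundTime n = rowsTime n (pred n) + (n + 1 + (n * n + 1))

length-rowMajor : (f : Fin m → Fin n → Bool) → length (rowMajor f) ≡ m * n
length-rowMajor {zero}  f = refl
length-rowMajor {suc m} f = trans (length-++ (tabulate (f zero)))
  (cong₂ _+_ (length-tabulate (f zero)) (length-rowMajor (f ∘ suc)))

-- The zero matrix of the first round is represented by blank cells.
Represents : Matrix n → List Sym → Set
Represents p ps = ∀ w → PassRows p w (load [ nothing ] ps) (tape (cells (rowMajor w) ʳ++ [ nothing ]) nothing [])

round-run : (e p : Matrix (suc n)) (r : Fin (suc n) → Bool) → ∀ {I I′} os {K ps} →
  PassRows e e I I′ → Represents p ps →
  (scan , I ∷ load (cells os ʳ++ []) [] ∷ K ∷ load [ nothing ] ps ∷ startOf r ∷ startOf r ∷ startOf r ∷ []) ⟶[ roundTime (suc n) ]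
  atHeader I′ (os ++ rowMajor (released e p r r)) K (cells (rowMajor (held e p r r)) ++ [ nothing ]) (reached e p r r)
round-run {n} e p r os I↦ P↦
  rewrite sym (cells-++ʳ os (rowMajor (released e p r r)) [])
  = scan-rows n e p r r r I↦ (passRows-blank (released e p r r) _) (P↦ (held e p r r))
  ▷ commit-run r r (reached e p r r)
  ▷ rewindP-run (rowMajor (held e p r r)) (length-rowMajor (held e p r r))

-- The complete run after initialisation

Halts : Config → ℕ → List Bool → Set
Halts c t y = ∃[ c′ ] (c ⟶[ t ] c′ × step c′ ≡ nothing × outputOf c′ ≡ y)

_▶_ : ∀ {c c′ s t y} → c ⟶[ s ] c′ → Halts c′ t y → Halts c (s + t) y
ps ▶ (c , qs , h) = c , ps ▷ qs , h

leadingBits-cells : ∀ ys → leadingBits {0} (cells ys) ≡ ys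
leadingBits-cells []       = refl
leadingBits-cells (y ∷ ys) = cong (y ∷_) (leadingBits-cells ys)

readOutput-load : ∀ ls ys → readOutput (load ls (cells ys)) ≡ ys
readOutput-load ls []       = refl
readOutput-load ls (y ∷ ys) = leadingBits-cells (y ∷ ys)

rewindOutput-loop : ∀ {k} bs → length bs ≡ k → ∀ {I rs v} →
  (rewindOutput , I ∷ loadˡ (cells bs) rs ∷ v) ⟶[ k + 1 ] (done , I ∷ load [ nothing ] (cells bs ʳ++ rs) ∷ v)
rewindOutput-loop [] refl {I} {rs} {_ ∷ _ ∷ _ ∷ _ ∷ _ ∷ []} =
  ∷⟨ refl , cong (λ o → done , I ∷ o ∷ _) (right-load [] nothing rs) ⟩ []
rewindOutput-loop (b ∷ bs) refl {I} {rs} {_ ∷ _ ∷ _ ∷ _ ∷ _ ∷ []} =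
  ∷⟨ refl , cong (λ o → rewindOutput , I ∷ o ∷ _) (left-loadˡ (cells bs) (bit b) rs) ⟩ rewindOutput-loop bs refl

finish : ∀ {li i} os {rk ps} {r : Fin n → Bool} → bitOf i ≡ false →
  Halts (atHeader (tape li i []) os (tape [] nothing rk) ps r) (suc (length (os ++ [ false ]))) (os ++ [ false ])
finish {li = li} {i} os {rk} {ps} {r} eq =
  (done , tape li i [] ∷ load [ nothing ] (cells (os ++ [ false ])) ∷ _) , run , refl , readOutput-load _ (os ++ [ false ])
  where
  K = tape [] nothing rk
  rest = load [ nothing ] ps ∷ startOf r ∷ startOf r ∷ startOf r ∷ []

  first : step (atHeader (tape li i []) os K ps r) ≡
          just (rewindOutput , tape li i [] ∷ moveHead left (tape (cells os ʳ++ []) (bit false) []) ∷ K ∷ rest)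
  first rewrite eq = refl

  rewound : cells (reverse os) ʳ++ [ bit false ] ≡ cells (os ++ [ false ])
  rewound = trans (unreverse os _) (sym (map-++ _ os [ false ]))

  run : atHeader (tape li i []) os K ps r ⟶[ suc (length (os ++ [ false ])) ]
        (done , tape li i [] ∷ load [ nothing ] (cells (os ++ [ false ])) ∷ K ∷ rest)
  run rewrite length-++ os {[ false ]} | sym rewound =
    ∷⟨ first , cong (λ o → rewindOutput , tape li i [] ∷ o ∷ K ∷ rest)
                 (trans (left-loadˡ (cells os ʳ++ []) (bit false) [])
                   (cong (λ ls → loadˡ ls [ bit false ]) (trans (cells-reverse os []) (++-identityʳ _)))) ⟩
    rewindOutput-loop (reverse os) (length-reverse os)

-- Rounds are peeled off at the front, as the machine consumes snapshots. The correctness proof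
-- needs the recurrence at the last round instead, which `heldAt-suc`, `reachedAt-suc` and
-- `releasedAt-released` provide.
heldAt releasedAt : (ℕ → Matrix n) → Matrix n → (Fin n → Bool) → ℕ → Matrix n
heldAt E p r zero    = p
heldAt E p r (suc t) = heldAt (E ∘ suc) (held (E 0) p r r) (reached (E 0) p r r) t
releasedAt E p r zero    = released (E 0) p r r
releasedAt E p r (suc t) = releasedAt (E ∘ suc) (held (E 0) p r r) (reached (E 0) p r r) t

reachedAt : (ℕ → Matrix n) → Matrix n → (Fin n → Bool) → ℕ → Fin n → Bool
reachedAt E p r zero    = r
reachedAt E p r (suc t) = reachedAt (E ∘ suc) (held (E 0) p r r) (reached (E 0) p r r) t

-- Empty snapshots continue the sequence, so the additional rounds need no separate definition.
snapAt : (Fin k → Matrix n) → ℕ → Matrix n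
snapAt {zero}  S t       u w = false
snapAt {suc k} S zero    u w = S zero u w
snapAt {suc k} S (suc t) u w = snapAt (S ∘ suc) t u w

encodeSequence : (Fin k → Matrix n) → List Bool
encodeSequence S = concat (tabulate λ i → true ∷ rowMajor (S i)) ++ [ false ]

encode-∷ : ∀ os (S : Fin (suc k) → Matrix n) →
  ((os ++ [ true ]) ++ rowMajor (S zero)) ++ encodeSequence (S ∘ suc) ≡ os ++ encodeSequence S
encode-∷ os S = trans (++-assoc (os ++ [ true ]) _ _) (trans (++-assoc os _ _)
  (cong (os ++_) (cong (true ∷_) (sym (++-assoc (rowMajor (S zero)) _ [ false ])))))

write-true : ∀ os → load (bit true ∷ (cells os ʳ++ [])) [] ≡ load (cells (os ++ [ true ]) ʳ++ []) []
write-true os = cong (λ ls → load ls []) (cells-++ʳ os [ true ] [])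

released-sequence : (ℕ → Matrix n) → Matrix n → (Fin n → Bool) → ∀ k → Fin k → Matrix n
released-sequence E p r k i = releasedAt E p r (toℕ i)

-- The output `y` includes the prefix `os` already written and is therefore the same at every round;
-- `suc (length y)` pays for the final rewinding. The list `rk` is arbitrary because spent counter
-- marks pile up to the right of the head.
LoopHalts : Tape Sym → List Bool → ℕ → List Sym → (E : ℕ → Matrix n) → Matrix n → (Fin n → Bool) → ℕ → Set
LoopHalts {n} I os m ps E p r rounds = ∀ {rk} →
  let y = os ++ encodeSequence (released-sequence E p r rounds)
  in Halts (atHeader I os (loadˡ (replicate m (bit true)) rk) ps r) (rounds * suc (roundTime n) + suc (length y)) y

represents-held : (p : Matrix n) → Represents p (cells (rowMajor p) ++ [ nothing ])
represents-held p w = passRows-cells p w [ nothing ] [ nothing ]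

represents-blank : Represents {n} (λ _ _ → false) []
represents-blank w = passRows-blank w [ nothing ]

-- The induction step shared by rounds with and without a snapshot. They differ only in the step out
-- of `header`, which is a hypothesis here.
round-then : ∀ {N} {I I₁ I′ os ps E p r K K₁ rounds} → let n = suc N in
  (enter : step (atHeader {n} I os K ps r) ≡
           just (scan , I₁ ∷ load (bit true ∷ (cells os ʳ++ [])) [] ∷ K₁ ∷ load [ nothing ] ps ∷
                        startOf r ∷ startOf r ∷ startOf r ∷ [])) →
  PassRows (E 0) (E 0) I₁ I′ → Represents p ps →
  let p₁ = held (E 0) p r r
      r₁ = reached (E 0) p r r
      os₁ = (os ++ [ true ]) ++ rowMajor (released (E 0) p r r)
      y₁ = os₁ ++ encodeSequence (released-sequence (E ∘ suc) p₁ r₁ rounds)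
      y = os ++ encodeSequence (released-sequence E p r (suc rounds))
  in Halts (atHeader I′ os₁ K₁ (cells (rowMajor p₁) ++ [ nothing ]) r₁) (rounds * suc (roundTime n) + suc (length y₁)) y₁ →
     Halts (atHeader I os K ps r) (suc rounds * suc (roundTime n) + suc (length y)) y
round-then {N} {I₁ = I₁} {os = os} {ps} {E} {p} {r} {K₁ = K₁} {rounds} enter I↦ P↦ rest
  rewrite sym (encode-∷ os (released-sequence E p r (suc rounds)))
        | +-assoc (roundTime (suc N)) (rounds * suc (roundTime (suc N)))
            (suc (length (((os ++ [ true ]) ++ rowMajor (released (E 0) p r r)) ++
              encodeSequence (released-sequence (E ∘ suc) (held (E 0) p r r) (reached (E 0) p r r) rounds))))
  = (∷⟨ enter , cong (λ o → scan , I₁ ∷ o ∷ K₁ ∷ load [ nothing ] ps ∷ startOf r ∷ startOf r ∷ startOf r ∷ []) (write-true os) ⟩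
     round-run (E 0) p r (os ++ [ true ]) {ps = ps} I↦ P↦) ▶ rest

-- The symbol `i` is the closing `false` of the input in the first of these rounds and a blank
-- afterwards; both are read as `false`.
loop-tail : ∀ {N} m {li i os ps p r} → bitOf i ≡ false → Represents {suc N} p ps →
  LoopHalts (tape li i []) os m ps (λ _ _ _ → false) p r m
loop-tail zero {os = os} {ps} {r = r} i≡ P↦ = finish os {ps = ps} {r} i≡
loop-tail {N} (suc m) {li} {i} {os} {ps} {p} {r} i≡ P↦ {rk} =
  round-then {os = os} {ps} {λ _ _ _ → false} {p} {r} {rounds = m} enter
    (passRows-blank (λ _ _ → false) (i ∷ li)) P↦
    (loop-tail m {os = (os ++ [ true ]) ++ rowMajor (released e p r r)} {cells (rowMajor (held e p r r)) ++ [ nothing ]} {r = reached e p r r}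
      refl (represents-held (held e p r r)))
  where
  e : Matrix (suc N)
  e _ _ = false
  enter : step (atHeader (tape li i []) os (loadˡ (replicate (suc m) (bit true)) rk) ps r) ≡
          just (scan , load (i ∷ li) [] ∷ load (bit true ∷ (cells os ʳ++ [])) [] ∷ loadˡ (replicate m (bit true)) (bit true ∷ rk) ∷
                       load [ nothing ] ps ∷ startOf r ∷ startOf r ∷ startOf r ∷ [])
  enter rewrite i≡ | left-loadˡ (replicate m (bit true)) (bit true) rk = refl

loop : ∀ {N} {k} (S : Fin k → Matrix (suc N)) m {li os ps p r} → Represents p ps →
  LoopHalts (load li (cells (encodeSequence S))) os m ps (snapAt S) p r (k + m)
loop {k = zero} S m {os = os} {ps} {p} {r} P↦ = loop-tail m {os = os} {ps} {p} {r} refl P↦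
loop {k = suc k} S m {li} {os} {ps} {p} {r} P↦ {rk} =
  round-then {os = os} {ps} {snapAt S} {p} {r} {rounds = k + m} enter
    (passRows-cells (S zero) (S zero) (bit true ∷ li) rest) P↦
    (loop (S ∘ suc) m {os = (os ++ [ true ]) ++ rowMajor (released (S zero) p r r)}
      {cells (rowMajor (held (S zero) p r r)) ++ [ nothing ]} {r = reached (S zero) p r r}
      (represents-held (held (S zero) p r r)))
  where
  rest = cells (encodeSequence (S ∘ suc))
  K = loadˡ (replicate m (bit true)) rk
  split : cells (encodeSequence S) ≡ bit true ∷ (cells (rowMajor (S zero)) ++ rest)
  split = cong (bit true ∷_) (trans (cong cells (++-assoc (rowMajor (S zero)) _ [ false ]))
                                    (map-++ _ (rowMajor (S zero)) _))
  enter : step (atHeader (load li (cells (encodeSequence S))) os K ps r) ≡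
          just (scan , load (bit true ∷ li) (cells (rowMajor (S zero)) ++ rest) ∷
                       load (bit true ∷ (cells os ʳ++ [])) [] ∷ K ∷
                       load [ nothing ] ps ∷ startOf r ∷ startOf r ∷ startOf r ∷ [])
  enter = trans (cong (λ cs → step (atHeader (load li cs) os K ps r)) split)
                (cong (λ τ → just (scan , τ ∷ load (bit true ∷ (cells os ʳ++ [])) [] ∷ K ∷ load [ nothing ] ps ∷
                                        startOf r ∷ startOf r ∷ startOf r ∷ [])) (right-load li (bit true) (cells (rowMajor (S zero)) ++ rest)))

-- Reading `n` and the source

replicate-shift : ∀ {A : Set} k (x : A) xs → replicate k x ++ x ∷ xs ≡ x ∷ replicate k x ++ xs
replicate-shift zero    x xs = refl
replicate-shift (suc k) x xs = cong (x ∷_) (replicate-shift k x xs)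

-- The three vertex sets are written from right to left, so their heads end at the first cell with
-- no rewinding. The counter head ends on its last mark.
copy-loop : ∀ k {li rest lo lk P rx} →
  (copy , load li (cells (unary k ++ rest)) ∷ load lo [] ∷ tape lk nothing [] ∷ P ∷
          tape [] nothing rx ∷ tape [] nothing rx ∷ tape [] nothing rx ∷ []) ⟶[ k + 1 ]
  (locate , load (cells (unary k) ʳ++ li) (cells rest) ∷ load (cells (unary k) ʳ++ lo) [] ∷
            loadˡ (replicate k (bit true) ++ lk) [ nothing ] ∷ P ∷
            load [ nothing ] (replicate k (bit false) ++ rx) ∷ load [ nothing ] (replicate k (bit false) ++ rx) ∷
            load [ nothing ] (replicate k (bit false) ++ rx) ∷ [])
copy-loop zero {li} {rest} {lo} {lk} {P} {rx}
  rewrite sym (right-load li (bit false) (cells rest)) | sym (right-load [] nothing rx)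
        | sym (left-loadˡ lk nothing []) = refl ∷ []
copy-loop (suc k) {li} {rest} {lo} {lk} {P} {rx} =
  ∷⟨ refl , cong (λ τ → copy , τ ∷ load (bit true ∷ lo) [] ∷ tape (bit true ∷ lk) nothing [] ∷ P ∷ Z ∷ Z ∷ Z ∷ [])
              (right-load li (bit true) (cells (unary k ++ rest))) ⟩
  subst₂ (λ ks xs → (copy , load (bit true ∷ li) (cells (unary k ++ rest)) ∷ load (bit true ∷ lo) [] ∷
                            tape (bit true ∷ lk) nothing [] ∷ P ∷ Z ∷ Z ∷ Z ∷ []) ⟶[ k + 1 ]
                    (locate , load (cells (unary k) ʳ++ (bit true ∷ li)) (cells rest) ∷
                              load (cells (unary k) ʳ++ (bit true ∷ lo)) [] ∷ loadˡ ks [ nothing ] ∷ P ∷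
                              load [ nothing ] xs ∷ load [ nothing ] xs ∷ load [ nothing ] xs ∷ []))
    (replicate-shift k (bit true) lk) (replicate-shift k (bit false) rx) (copy-loop k)
  where Z = tape [] nothing (bit false ∷ rx)

singleton : Fin n → Fin n → Bool
singleton zero    zero    = true
singleton zero    (suc w) = false
singleton (suc v) zero    = false
singleton (suc v) (suc w) = singleton v w

replicate-tabulate-false : ∀ m → replicate m (bit false) ≡ cells (tabulate {n = m} (λ _ → false))
replicate-tabulate-false zero    = refl
replicate-tabulate-false (suc m) = cong (bit false ∷_) (replicate-tabulate-false m)

locate-loop : (v : Fin (suc m)) → ∀ {b} bs → length bs ≡ b → ∀ {li rest O K P} →
  let Z = load (cells bs ++ [ nothing ]) (replicate (suc m) (bit false) ++ [ nothing ])
      Z′ = load [ nothing ] (cells bs ʳ++ (cells (tabulate (singleton v)) ++ [ nothing ])) in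
  (locate , load li (cells (unary (toℕ v) ++ rest)) ∷ O ∷ K ∷ P ∷ Z ∷ Z ∷ Z ∷ [])
    ⟶[ toℕ v + suc (suc (toℕ v + b) + 1) ]
  (rewindP , load (cells (unary (toℕ v)) ʳ++ li) (cells rest) ∷ O ∷ K ∷ moveHead left P ∷ Z′ ∷ Z′ ∷ Z′ ∷ [])
locate-loop {m} zero bs refl {li} {rest}
  rewrite replicate-tabulate-false m =
  ∷⟨ refl , cong (λ τ → commit , τ ∷ _) (right-load li (bit false) (cells rest)) ⟩
  -- The copying starts at the source and goes left; the cells to its right are `false` on all three
  -- tapes already.
  commit-loop (false ∷ bs) (false ∷ bs) (true ∷ bs) refl refl refl
locate-loop {suc m} (suc v) {b} bs eq {li} {rest} {O} {K} {P}
  rewrite sym (cong (_+ 1) (+-suc (toℕ v) b)) =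
  ∷⟨ refl , cong (λ τ → locate , τ ∷ O ∷ K ∷ P ∷ _) (right-load li (bit true) (cells (unary (toℕ v) ++ rest))) ⟩
  locate-loop v (false ∷ bs) (cong suc eq)

initTime : ℕ → ℕ → ℕ
initTime n v = suc (n + 1 + (v + suc (suc (v + 0) + 1) + 1))

init-run : ∀ {N} (v : Fin (suc N)) rest → let n = suc N in
  initial (unary n ++ unary (toℕ v) ++ rest) ⟶[ initTime n (toℕ v) ]
  atHeader (load (cells (unary (toℕ v)) ʳ++ (cells (unary n) ʳ++ [])) (cells rest)) (unary n)
           (loadˡ (replicate n (bit true)) [ nothing ]) [] (singleton v)
init-run {N} v rest rewrite sym (++-identityʳ (replicate N (bit true))) =
  refl ∷
  (copy-loop (suc N) {rest = unary (toℕ v) ++ rest} {lk = []} ▷ locate-loop v [] refl {rest = rest} ▷ rewindP-run [] refl)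

runTime : ℕ → ℕ → ℕ → ℕ
runTime n v k = initTime n v + ((k + n) * suc (roundTime n) + suc (n + 1 + ((k + n) * suc (n * n) + 1)))

delayed : (Fin k → Matrix n) → Fin n → Fin (k + n) → Matrix n
delayed {k} {n} S v = released-sequence (snapAt S) (λ _ _ → false) (singleton v) (k + n)

length-unary : ∀ n → length (unary n) ≡ n + 1
length-unary n = trans (length-++ (replicate n true)) (cong (_+ 1) (length-replicate n))

length-encodeSequence : (S : Fin k → Matrix n) → length (encodeSequence S) ≡ k * suc (n * n) + 1
length-encodeSequence {zero}      S = refl
length-encodeSequence {suc k} {n} S = cong suc (trans (cong length (++-assoc (rowMajor (S zero)) _ [ false ]))
  (trans (length-++ (rowMajor (S zero))) (trans (cong₂ _+_ (length-rowMajor (S zero)) (length-encodeSequence (S ∘ suc)))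
    (sym (+-assoc (n * n) (k * suc (n * n)) 1)))))

machine-computes : (S : Fin k → Matrix n) (v : Fin n) →
  Computes[ runTime n (toℕ v) k ] (unary n ++ unary (toℕ v) ++ encodeSequence S) (unary n ++ encodeSequence (delayed S v))
-- The source rules out `n = 0`, and `round-run` assumes at least one row.
machine-computes {k} {n@(suc _)} S v =
  subst (λ l → Computes[ initTime n (toℕ v) + ((k + n) * suc (roundTime n) + suc l) ]
                 (unary n ++ unary (toℕ v) ++ encodeSequence S) (unary n ++ encodeSequence (delayed S v)))
    (trans (length-++ (unary n)) (cong₂ _+_ (length-unary n) (length-encodeSequence (delayed S v))))
    (computes (unary n ++ unary (toℕ v) ++ encodeSequence S) (init-run v (encodeSequence S) ▶
               loop S n {os = unary n} {ps = []} {r = singleton v} represents-blank))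
  where
  computes : ∀ x {t y} → Halts (initial x) t y → Computes[ t ] x y
  computes x (c , run , stop , out) = c , halts run stop , out

-- Running time

rowsTime-bound : ∀ n k → rowsTime n k ≤ suc k * (2 * n + 3)
rowsTime-bound n zero    = begin
  n + 2             ≤⟨ m≤m+n (n + 2) (n + 1) ⟩
  n + 2 + (n + 1)   ≡⟨ solve 1 (λ n → n :+ con 2 :+ (n :+ con 1) := con 1 :* (con 2 :* n :+ con 3)) refl n ⟩
  1 * (2 * n + 3)   ∎
  where open ≤-Reasoning; open +-*-Solver
rowsTime-bound n (suc k) = begin
  n + (2 + (n + 1 + rowsTime n k))           ≤⟨ +-monoʳ-≤ n (+-monoʳ-≤ 2 (+-monoʳ-≤ (n + 1) (rowsTime-bound n k))) ⟩
  n + (2 + (n + 1 + suc k * (2 * n + 3)))    ≡⟨ solve 2 (λ n x → n :+ (con 2 :+ (n :+ con 1 :+ x)) := con 2 :* n :+ con 3 :+ x) refl n _ ⟩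
  2 * n + 3 + suc k * (2 * n + 3)            ∎
  where open ≤-Reasoning; open +-*-Solver

roundTime-bound : ∀ n → 1 ≤ n → roundTime n ≤ 3 * (n * n) + 4 * n + 2
roundTime-bound n@(suc N) _ = begin
  rowsTime n N + (n + 1 + (n * n + 1))            ≤⟨ +-monoˡ-≤ _ (rowsTime-bound n N) ⟩
  n * (2 * n + 3) + (n + 1 + (n * n + 1))         ≡⟨ solve 1 (λ n → n :* (con 2 :* n :+ con 3) :+ (n :+ con 1 :+ (n :* n :+ con 1)) := con 3 :* (n :* n) :+ con 4 :* n :+ con 2) refl n ⟩
  3 * (n * n) + 4 * n + 2                         ∎
  where open ≤-Reasoning; open +-*-Solver

-- At most `2 * L` rounds of quadratic length give degree 3.
runTime-bound : ∀ {n v k L} → 1 ≤ n → n ≤ L → v ≤ L → k ≤ L → runTime n v k ≤ 37 * L ^ 3 + 37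
runTime-bound {n} {v} {k} {L} 1≤n n≤L v≤L k≤L = begin
  runTime n v k
    ≤⟨ +-mono-≤
         (s≤s (+-mono-≤ (+-monoˡ-≤ 1 n≤L) (+-monoˡ-≤ 1 (+-mono-≤ v≤L (s≤s (+-monoˡ-≤ 1 (s≤s (+-monoˡ-≤ 0 v≤L))))))))
         (+-mono-≤ (*-mono-≤ k+n≤ (s≤s (≤-trans (roundTime-bound n 1≤n)
                      (+-monoˡ-≤ 2 (+-mono-≤ (*-monoʳ-≤ 3 n²≤) (*-monoʳ-≤ 4 n≤L))))))
                   (s≤s (+-mono-≤ (+-monoˡ-≤ 1 n≤L) (+-monoˡ-≤ 1 (*-mono-≤ k+n≤ (s≤s n²≤)))))) ⟩
  initTime L L + ((L + L) * suc (3 * (L * L) + 4 * L + 2) + suc (L + 1 + ((L + L) * suc (L * L) + 1)))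
    ≡⟨ solve 1 (λ L →
         con 1 :+ (L :+ con 1 :+ (L :+ (con 1 :+ (con 1 :+ (L :+ con 0) :+ con 1)) :+ con 1)) :+
         ((L :+ L) :* (con 1 :+ (con 3 :* (L :* L) :+ con 4 :* L :+ con 2)) :+
          (con 1 :+ (L :+ con 1 :+ ((L :+ L) :* (con 1 :+ L :* L) :+ con 1))))
         := con 8 :* L :^ 3 :+ con 8 :* L :^ 2 :+ con 12 :* L :^ 1 :+ con 9) refl L ⟩
  8 * L ^ 3 + 8 * L ^ 2 + 12 * L ^ 1 + 9
    ≤⟨ +-monoˡ-≤ 9 (+-mono-≤ (+-monoʳ-≤ (8 * L ^ 3) (*-monoʳ-≤ 8 (^-monoʳ-≤ L {2} {3} (s≤s (s≤s z≤n)))))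
                              (*-monoʳ-≤ 12 (^-monoʳ-≤ L {1} {3} (s≤s z≤n)))) ⟩
  8 * L ^ 3 + 8 * L ^ 3 + 12 * L ^ 3 + 9
    ≡⟨ solve 1 (λ x → con 8 :* x :+ con 8 :* x :+ con 12 :* x :+ con 9 := con 28 :* x :+ con 9) refl (L ^ 3) ⟩
  28 * L ^ 3 + 9
    -- `PolyTimeSolves` has a single constant for coefficient and summand, so both become `28 + 9`.
    ≤⟨ +-mono-≤ (*-monoˡ-≤ (L ^ 3) (m≤m+n 28 9)) (m≤m+n 9 28) ⟩
  37 * L ^ 3 + 37 ∎
  where
  open ≤-Reasoning; open +-*-Solver
  instance _ = >-nonZero (≤-trans 1≤n n≤L)
  n²≤ : n * n ≤ L * L
  n²≤ = *-mono-≤ n≤L n≤L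
  k+n≤ : k + n ≤ L + L
  k+n≤ = +-mono-≤ k≤L n≤L

-- The unary codes bound `n` and `v` by the input length, and each snapshot has at least its leading
-- `true`, which bounds `k`.
runTime-polynomial : (S : Fin k → Matrix n) (v : Fin n) →
  runTime n (toℕ v) k ≤ 37 * length (unary n ++ unary (toℕ v) ++ encodeSequence S) ^ 3 + 37
runTime-polynomial {k} {n@(suc _)} S v = runTime-bound (s≤s z≤n)
  (≤-trans (≤-trans (m≤m+n n 1) (m≤m+n _ _)) (≤-reflexive (sym len)))
  (≤-trans (≤-trans (≤-trans (m≤m+n (toℕ v) 1) (m≤m+n _ (k * suc (n * n) + 1))) (m≤n+m _ (n + 1))) (≤-reflexive (sym len)))
  (≤-trans (≤-trans (≤-trans (≤-trans (m≤m*n k (suc (n * n))) (m≤m+n _ 1)) (m≤n+m _ (toℕ v + 1))) (m≤n+m _ (n + 1))) (≤-reflexive (sym len)))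
  where
  len : length (unary n ++ unary (toℕ v) ++ encodeSequence S) ≡ n + 1 + (toℕ v + 1 + (k * suc (n * n) + 1))
  len = trans (length-++ (unary n)) (cong₂ _+_ (length-unary n)
          (trans (length-++ (unary (toℕ v))) (cong₂ _+_ (length-unary (toℕ v)) (length-encodeSequence S))))

-- Correctness of the sweep

open Equivalence using (to; from)

T-not⁻ : ∀ {b} → T (not b) → ¬ T b
T-not⁻ {false} _ ()

T-not⁺ : ∀ {b} → ¬ T b → T (not b)
T-not⁺ {false} _  = _
T-not⁺ {true}  ¬b = ¬b _

reached-base : (e p : Fin m → Fin n → Bool) (r : Fin m → Bool) (z : Fin n → Bool) → ∀ {w} →
  T (z w) → T (reached e p r z w)
reached-base {zero}  e p r z h = h
reached-base {suc m} e p r z h = reached-base (e ∘ suc) (p ∘ suc) (r ∘ suc) _ (from T-∨ (inj₁ h))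

reached-edge : (e p : Fin m → Fin n → Bool) (r : Fin m → Bool) (z : Fin n → Bool) → ∀ {u w} →
  T (e u w ∨ p u w) → T (r u) → T (reached e p r z w)
reached-edge e p r z {zero}  q h = reached-base (e ∘ suc) (p ∘ suc) (r ∘ suc) _ (from T-∨ (inj₂ (from T-∧ (q , h))))
reached-edge e p r z {suc u} q h = reached-edge (e ∘ suc) (p ∘ suc) (r ∘ suc) _ q h

reached-cases : (e p : Fin m → Fin n → Bool) (r : Fin m → Bool) (z : Fin n → Bool) → ∀ {w} →
  T (reached e p r z w) → T (z w) ⊎ (∃[ u ] (T (e u w ∨ p u w) × T (r u)))
reached-cases {zero}  e p r z h = inj₁ h
reached-cases {suc m} e p r z h with reached-cases (e ∘ suc) (p ∘ suc) (r ∘ suc) _ h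
... | inj₂ (u , q , ru) = inj₂ (suc u , q , ru)
... | inj₁ h′ with to T-∨ h′
...   | inj₁ zw = inj₁ zw
...   | inj₂ q  = inj₂ (zero , to T-∧ q)

heldAt-suc : (E : ℕ → Matrix n) → ∀ p r t →
  heldAt E p r (suc t) ≡ held (E t) (heldAt E p r t) (reachedAt E p r t) (reachedAt E p r t)
heldAt-suc E p r zero    = refl
heldAt-suc E p r (suc t) = heldAt-suc (E ∘ suc) _ _ t

reachedAt-suc : (E : ℕ → Matrix n) → ∀ p r t →
  reachedAt E p r (suc t) ≡ reached (E t) (heldAt E p r t) (reachedAt E p r t) (reachedAt E p r t)
reachedAt-suc E p r zero    = refl
reachedAt-suc E p r (suc t) = reachedAt-suc (E ∘ suc) _ _ t

releasedAt-released : (E : ℕ → Matrix n) → ∀ p r t →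
  releasedAt E p r t ≡ released (E t) (heldAt E p r t) (reachedAt E p r t) (reachedAt E p r t)
releasedAt-released E p r zero    = refl
releasedAt-released E p r (suc t) = releasedAt-released (E ∘ suc) _ _ t

singleton-refl : (v : Fin n) → T (singleton v v)
singleton-refl zero    = _
singleton-refl (suc v) = singleton-refl v

singleton-≡ : (v w : Fin n) → T (singleton v w) → v ≡ w
singleton-≡ zero    zero    _ = refl
singleton-≡ (suc v) (suc w) h = cong suc (singleton-≡ v w h)

snapAt-intro : (S : Fin k → Matrix n) → ∀ i {u w} → T (S i u w) → T (snapAt S (toℕ i) u w)
snapAt-intro S zero    h = h
snapAt-intro S (suc i) h = snapAt-intro (S ∘ suc) i h

snapAt-elim : (S : Fin k → Matrix n) → ∀ t {u w} → T (snapAt S t u w) → ∃[ i ] (t ≡ toℕ i × T (S i u w))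
snapAt-elim {suc k} S zero    h = zero , refl , h
snapAt-elim {suc k} S (suc t) h with snapAt-elim (S ∘ suc) t h
... | i , eq , h′ = suc i , cong suc eq , h′

-- first f k is k when f is false below k.
first : (ℕ → Bool) → ℕ → ℕ
first f zero    = 0
first f (suc k) = if f 0 then 0 else suc (first (f ∘ suc) k)

first-cong : ∀ {f g} → (∀ d → f d ≡ g d) → ∀ k → first f k ≡ first g k
first-cong         eq zero    = refl
first-cong {f} {g} eq (suc k) = cong₂ (λ b d → if b then 0 else suc d) (eq 0) (first-cong (eq ∘ suc) k)

-- The bound `k` only limits the search; a hit at some `d ≤ k` makes the result a true minimum.
first-least : ∀ f k d → d ≤ k → T (f d) →
  T (f (first f k)) × first f k ≤ d × (∀ c → c < first f k → ¬ T (f c))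
first-least f zero    zero    _   h = h , z≤n , λ _ ()
first-least f (suc k) d       d≤k h with f 0 in eq
... | true = subst T (sym eq) _ , z≤n , λ _ ()
first-least f (suc k) zero    d≤k h       | false = ⊥-elim (subst T eq h)
first-least f (suc k) (suc d) (s≤s d≤k) h | false with first-least (f ∘ suc) k d d≤k h
... | here , least , before = here , s≤s least , λ where
  zero    _         → subst T eq
  (suc c) (s≤s c<k) → before c c<k

-- Held edges and reached vertices in each round

module Process (E : ℕ → Matrix n) (E-symm : ∀ t u w → E t u w ≡ E t w u) (v : Fin n) where

  P : ℕ → Matrix n
  P = heldAt E (λ _ _ → false) (singleton v)

  -- The set before round `t`, where that round releases label `suc t`; membership thus corresponds
  -- to arrival time at most `t`.
  R : ℕ → Fin n → Bool
  R = reachedAt E (λ _ _ → false) (singleton v)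

  Q touched output : ℕ → Matrix n
  Q t u w = E t u w ∨ P t u w
  touched t u w = R t u ∨ R t w
  output = releasedAt E (λ _ _ → false) (singleton v)

  output-≡ : ∀ t u w → output t u w ≡ Q t u w ∧ touched t u w
  output-≡ t u w = cong (λ f → f u w) (releasedAt-released E (λ _ _ → false) (singleton v) t)

  P-suc : ∀ t u w → P (suc t) u w ≡ Q t u w ∧ not (touched t u w)
  P-suc t u w = cong (λ f → f u w) (heldAt-suc E (λ _ _ → false) (singleton v) t)

  R-suc : ∀ t w → R (suc t) w ≡ reached (E t) (P t) (R t) (R t) w
  R-suc t w = cong (λ f → f w) (reachedAt-suc E (λ _ _ → false) (singleton v) t)

  touched-symm : ∀ t u w → touched t u w ≡ touched t w u
  touched-symm t u w = ∨-comm (R t u) (R t w)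

  Q-symm : ∀ t u w → Q t u w ≡ Q t w u
  Q-symm t u w = cong₂ _∨_ (E-symm t u w) (P-symm t)
    where
    P-symm : ∀ t → P t u w ≡ P t w u
    P-symm zero    = refl
    P-symm (suc t) = trans (P-suc t u w) (trans (cong₂ (λ q b → q ∧ not b) (Q-symm t u w) (touched-symm t u w)) (sym (P-suc t w u)))

  output-symm : ∀ t u w → output t u w ≡ output t w u
  output-symm t u w = trans (output-≡ t u w) (trans (cong₂ _∧_ (Q-symm t u w) (touched-symm t u w)) (sym (output-≡ t w u)))

  R-start : T (R 0 v)
  R-start = singleton-refl v

  R-step : ∀ t {w} → T (R t w) → T (R (suc t) w)
  R-step t {w} h = subst T (sym (R-suc t w)) (reached-base (E t) (P t) (R t) (R t) h)

  R-mono : ∀ {s t w} → s ≤ t → T (R s w) → T (R t w)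
  R-mono {s} {zero}  z≤n h = h
  R-mono {s} {suc t} s≤t h with m≤n⇒m<n∨m≡n s≤t
  ... | inj₁ (s≤s s≤t′) = R-step t (R-mono s≤t′ h)
  ... | inj₂ refl       = h

  R-edge : ∀ t {u w} → T (Q t u w) → T (R t u) → T (R (suc t) w)
  R-edge t {u} {w} q h = subst T (sym (R-suc t w)) (reached-edge (E t) (P t) (R t) (R t) q h)

  R-cases : ∀ t {w} → T (R (suc t) w) → T (R t w) ⊎ (∃[ u ] (T (Q t u w) × T (R t u)))
  R-cases t {w} h = reached-cases (E t) (P t) (R t) (R t) (subst T (R-suc t w) h)

  Q-suc : ∀ t {u w} → T (Q t u w) → ¬ T (touched t u w) → T (Q (suc t) u w)
  Q-suc t {u} {w} q ¬b = from T-∨ (inj₂ (subst T (sym (P-suc t u w)) (from T-∧ (q , T-not⁺ ¬b))))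

  Q-persists : ∀ {s t u w} → T (E s u w) → s ≤ t → (∀ r → s ≤ r → r < t → ¬ T (touched r u w)) → T (Q t u w)
  Q-persists {t = zero}  e z≤n _  = from T-∨ (inj₁ e)
  Q-persists {t = suc t} e s≤t ¬b with m≤n⇒m<n∨m≡n s≤t
  ... | inj₂ refl       = from T-∨ (inj₁ e)
  ... | inj₁ (s≤s s≤t′) = Q-suc t (Q-persists e s≤t′ λ r s≤r r<t → ¬b r s≤r (m≤n⇒m≤1+n r<t)) (¬b t s≤t′ ≤-refl)

  -- An edge stays held only while untouched, so it can be traced back to the snapshot that supplied
  -- it. `Q-persists` is the converse.
  Q-origin : ∀ t {u w} → T (Q t u w) →
    ∃[ s ] (s ≤ t × T (E s u w) × (∀ r → s ≤ r → r < t → ¬ T (touched r u w)))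
  Q-origin t q with to T-∨ q
  Q-origin t q | inj₁ e = t , ≤-refl , e , λ r t≤r r<t → contradiction t≤r (<⇒≱ r<t)
  Q-origin (suc t) {u} {w} q | inj₂ p with to T-∧ (subst T (P-suc t u w) p)
  ... | q′ , ¬b with Q-origin t q′
  ...   | s , s≤t , e , untouched = s , m≤n⇒m≤1+n s≤t , e , λ r s≤r r<1+t →
          [ untouched r s≤r , (λ { refl → T-not⁻ ¬b }) ]′ (m≤n⇒m<n∨m≡n (≤-pred r<1+t))

  -- An edge leaves the held set only when touched, and that round puts both endpoints into the
  -- reached set.
  Q-or-reached : ∀ {s t u w} → T (E s u w) → s ≤ t → T (Q t u w) ⊎ (T (R t u) × T (R t w))
  Q-or-reached {t = zero} e z≤n = inj₁ (from T-∨ (inj₁ e))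
  Q-or-reached {t = suc t} {u} {w} e s≤t with m≤n⇒m<n∨m≡n s≤t
  ... | inj₂ refl = inj₁ (from T-∨ (inj₁ e))
  ... | inj₁ (s≤s s≤t′) with Q-or-reached e s≤t′
  ...   | inj₂ (ru , rw) = inj₂ (R-step t ru , R-step t rw)
  ...   | inj₁ q with T? (touched t u w)
  ...     | no ¬b = inj₁ (Q-suc t q ¬b)
  ...     | yes b with to T-∨ b
  ...       | inj₁ ru = inj₂ (R-step t ru , R-edge t q ru)
  -- `reached` follows an edge from its row vertex only, so the edge is turned round.
  ...       | inj₂ rw = inj₂ (R-edge t (subst T (Q-symm t u w) q) rw , R-step t rw)

  -- This makes the sweep as fast as any delaying: holding an edge back never costs time, because
  -- the edge is released as soon as one endpoint is reached.
  R-closed : ∀ {s t u w} → T (E s u w) → s ≤ t → T (R t u) → T (R (suc t) w)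
  R-closed {t = t} e s≤t ru with Q-or-reached e s≤t
  ... | inj₁ q        = R-edge t q ru
  ... | inj₂ (_ , rw) = R-step t rw

  allReached : ℕ → Bool
  allReached t = ⌊ all? (λ w → T? (R t w)) ⌋

  allReached⁺ : ∀ {t} → (∀ w → T (R t w)) → T (allReached t)
  allReached⁺ {t} = fromWitness {a? = all? λ w → T? (R t w)}

  allReached⁻ : ∀ {t} → T (allReached t) → ∀ w → T (R t w)
  allReached⁻ {t} = toWitness {a? = all? λ w → T? (R t w)}

  reachedSet : ℕ → Subset n
  reachedSet t = Vec.tabulate (R t)

  ∈-reached⁺ : ∀ {t w} → T (R t w) → w ∈ reachedSet t
  ∈-reached⁺ {t} {w} h = lookup⇒[]= w (reachedSet t) (trans (lookup∘tabulate (R t) w) (to T-≡ h))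

  ∈-reached⁻ : ∀ {t w} → w ∈ reachedSet t → T (R t w)
  ∈-reached⁻ {t} {w} h = from T-≡ (trans (sym (lookup∘tabulate (R t) w)) ([]=⇒lookup h))

-- From the sweep to a delaying of least reaching time

module Delaying (G : TemporalGraph n) (v : Fin n) where

  open TemporalGraph G

  snapshots : Fin tmax → Matrix n
  snapshots i = Graph.adj (snapshot i)

  E : ℕ → Matrix n
  E = snapAt snapshots

  E-symm : ∀ t u w → E t u w ≡ E t w u
  E-symm = go snapshots (λ i → Graph.symm (snapshot i))
    where
    go : (S : Fin k → Matrix n) → (∀ i u w → S i u w ≡ S i w u) → ∀ t u w → snapAt S t u w ≡ snapAt S t w u
    go {zero}  S symm t       u w = refl
    go {suc k} S symm zero    u w = symm zero u w
    go {suc k} S symm (suc t) u w = go (S ∘ suc) (symm ∘ suc) t u w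

  open Process E E-symm v

  label⇒E : ∀ {u w i} → HasLabel G u w i → T (E (pred i) u w) × pred i < tmax × i ≡ suc (pred i)
  label⇒E (i , refl , e) = snapAt-intro snapshots i e , toℕ<n i , refl

  E⇒label : ∀ {s u w} → T (E s u w) → HasLabel G u w (suc s)
  E⇒label {s} e with snapAt-elim snapshots s e
  ... | i , refl , e′ = i , refl , e′

  output-irrefl : ∀ t u → ¬ T (output t u u)
  output-irrefl t u h with Q-origin t (proj₁ (to T-∧ (subst T (output-≡ t u u) h)))
  ... | s , _ , e , _ with snapAt-elim snapshots s e
  ...   | i , _ , e′ = Graph.irrefl (snapshot i) u e′

  -- The lower bound for all delayings at once. A delayed label is no smaller than the original, so
  -- by `R-closed` the sweep crosses each edge of the path no later than the path does.
  path⇒R : ∀ {G″ w t} → IsDelayingOf G G″ → TemporalPath G″ v w t → T (R t w)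
  path⇒R D empty = R-start
  path⇒R D@(δ , _ , labels) (extend {u} {w} path l t<t′) with to (labels u w _) l
  ... | i , h , refl with label⇒E {i = i} h
  ...   | e , _ , eq rewrite eq = R-closed e (m≤m+n (pred i) _) (R-mono (≤-pred t<t′) (path⇒R D path))

  -- The path starts inside `R T₀` and ends outside, so some edge leaves the set. Its original label
  -- comes from a snapshot before `tmax`, however far it was delayed.
  crossing : ∀ {G″ w t} T₀ → IsDelayingOf G G″ → TemporalPath G″ v w t → ¬ T (R T₀ w) →
    ∃[ s ] ∃[ x ] ∃[ y ] (s < tmax × T (E s x y) × T (R T₀ x) × ¬ T (R T₀ y))
  crossing T₀ D empty ¬w = contradiction (R-mono {0} {T₀} z≤n R-start) ¬w
  crossing T₀ D@(δ , _ , labels) (extend {u} {w} path l _) ¬w with T? (R T₀ u)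
  ... | no ¬u = crossing T₀ D path ¬u
  ... | yes ru with to (labels u w _) l
  ...   | i , h , _ with label⇒E {i = i} h
  ...     | e , s<tmax , _ = pred i , u , w , s<tmax , e , ru , ¬w

  -- From round `tmax` on every original label has appeared, so the edge found by `crossing` brings
  -- in a new vertex at once.
  growth : ∀ {G″} → IsDelayingOf G G″ → (∀ w → ∃[ t ] TemporalPath G″ v w t) →
    ∀ j → (∀ w → T (R (tmax + j) w)) ⊎ j < ∣ reachedSet (tmax + j) ∣
  -- The source alone makes the set nonempty.
  growth D paths zero = inj₂ (≤-trans (s≤s z≤n) (x∈p⇒∣p-x∣<∣p∣ (∈-reached⁺ {tmax + 0} {v} (R-mono {0} {tmax + 0} z≤n R-start))))
  growth D paths (suc j) rewrite +-suc tmax j with growth D paths j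
  ... | inj₁ all = inj₁ λ w → R-step (tmax + j) (all w)
  ... | inj₂ j<∣R∣ with all? (λ w → T? (R (tmax + j) w))
  ...   | yes all = inj₁ λ w → R-step (tmax + j) (all w)
  ...   | no ¬all with ¬∀⟶∃¬ n _ (λ w → T? (R (tmax + j) w)) ¬all
  ...     | w , ¬w with crossing (tmax + j) D (proj₂ (paths w)) ¬w
  ...       | s , x , y , s<tmax , e , rx , ¬y = inj₂ (≤-trans (s≤s j<∣R∣) (p⊂q⇒∣p∣<∣q∣
              ( (λ h → ∈-reached⁺ {suc (tmax + j)} (R-step (tmax + j) (∈-reached⁻ {tmax + j} h)))
              , y , ∈-reached⁺ {suc (tmax + j)} (R-closed e (≤-trans (<⇒≤ s<tmax) (m≤m+n tmax j)) rx)
              , λ h → ¬y (∈-reached⁻ {tmax + j} h) )))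

  all-reached : ∀ {G″} → IsDelayingOf G G″ → (∀ w → ∃[ t ] TemporalPath G″ v w t) → ∀ w → T (R (tmax + pred n) w)
  all-reached D paths = go n v refl
    where
    go : ∀ n′ → Fin n′ → n ≡ n′ → ∀ w → T (R (tmax + pred n) w)
    -- The source gives `n = suc N`, and a set with more than `N` of the `suc N` vertices is full.
    go (suc N) _ refl w with growth D paths N
    ... | inj₁ all  = all w
    ... | inj₂ N<∣R∣ = ∈-reached⁻ {tmax + N} (subst (w ∈_)
            (sym (∣p∣≡n⇒p≡⊤ (≤-antisym (∣p∣≤n (reachedSet (tmax + N))) N<∣R∣))) ∈⊤)

  module Connected (all-in : ∀ w → T (R (tmax + pred n) w)) where

    -- The index of the last round. All vertices are reached before it, so it touches every edge and
    -- leaves none held.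
    T₀ : ℕ
    T₀ = tmax + pred n

    T₀<rounds : T₀ < tmax + n
    T₀<rounds = +-monoʳ-< tmax (pred< v)
      where
      pred< : ∀ {n} → Fin n → pred n < n
      pred< {suc n} _ = ≤-refl

    rounds≤ : tmax + n ≤ suc T₀
    rounds≤ = subst (tmax + n ≤_) (+-suc tmax (pred n)) (+-monoʳ-≤ tmax (suc-pred≥ n))
      where
      suc-pred≥ : ∀ n → n ≤ suc (pred n)
      suc-pred≥ zero    = z≤n
      suc-pred≥ (suc n) = ≤-refl

    touched-T₀ : ∀ u w → T (touched T₀ u w)
    touched-T₀ u w = from T-∨ (inj₁ (all-in u))

    -- The wait from snapshot `pred i`, which carries label `i`, to the first round touching the
    -- edge. The search bound `T₀` suffices because round `T₀` touches every edge.
    delay : Fin n → Fin n → ℕ → ℕ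
    delay u w i = first (λ d → touched (pred i + d) u w) T₀

    delay-symm : ∀ u w i → delay u w i ≡ delay w u i
    delay-symm u w i = first-cong (λ d → touched-symm (pred i + d) u w) T₀

    delay-least : ∀ u w i t → pred i ≤ t → t ≤ T₀ → T (touched t u w) →
      T (touched (pred i + delay u w i) u w) × pred i + delay u w i ≤ t ×
      (∀ r → pred i ≤ r → r < pred i + delay u w i → ¬ T (touched r u w))
    delay-least u w i t s≤t t≤T₀ b
      with first-least (λ d → touched (pred i + d) u w) T₀ (t ∸ pred i) (≤-trans (m∸n≤m t (pred i)) t≤T₀)
             (subst (λ x → T (touched x u w)) (sym (m+[n∸m]≡n s≤t)) b)
    ... | here , least , before =
      here , subst (pred i + delay u w i ≤_) (m+[n∸m]≡n s≤t) (+-monoʳ-≤ (pred i) least) ,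
      λ r s≤r r<t → subst (λ x → ¬ T (touched x u w)) (m+[n∸m]≡n s≤r)
        (before (r ∸ pred i) (subst (r ∸ pred i <_) (m+n∸m≡n (pred i) _) (∸-monoˡ-< r<t s≤r)))

    -- The edge is untouched from its snapshot `s` until `t` and touched at `t`, so the wait of
    -- label `suc s` ends exactly there.
    output⇒label : ∀ {t u w} → t < tmax + n → T (output t u w) → ∃[ i ] (HasLabel G u w i × suc t ≡ i + delay u w i)
    output⇒label {t} {u} {w} t<rounds h with to T-∧ (subst T (output-≡ t u w) h)
    ... | q , b with Q-origin t q
    ...   | s , s≤t , e , untouched
      with delay-least u w (suc s) t s≤t (≤-pred (≤-trans t<rounds rounds≤)) b
    ...     | b′ , ≤t , _ with m≤n⇒m<n∨m≡n ≤t
    ...       | inj₂ eq = suc s , E⇒label e , cong suc (sym eq)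
    ...       | inj₁ <t = contradiction b′ (untouched _ (m≤m+n s _) <t)

    label⇒output : ∀ {u w i} → HasLabel G u w i →
      ∃[ t ] (t < tmax + n × T (output t u w) × i + delay u w i ≡ suc t)
    label⇒output {u} {w} {i} l with label⇒E {i = i} l
    ... | e , s<tmax , i≡ with delay-least u w i T₀ (≤-trans (<⇒≤ s<tmax) (m≤m+n tmax _)) ≤-refl (touched-T₀ u w)
    ...   | b , ≤T₀ , untouched =
      pred i + delay u w i , ≤-trans (s≤s ≤T₀) T₀<rounds ,
      subst T (sym (output-≡ _ u w)) (from T-∧ (Q-persists e (m≤m+n (pred i) _) untouched , b)) ,
      cong (_+ delay u w i) i≡

    G′ : TemporalGraph n
    G′ = record
      { static   = static
      ; tmax     = tmax + n
      ; snapshot = λ i → record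
          { adj    = delayed snapshots v i
          ; symm   = output-symm (toℕ i)
          ; irrefl = output-irrefl (toℕ i) }
      ; union    = λ u w → mk⇔ (static⇒output u w) (output⇒static u w) }
      where
      static⇒output : ∀ u w → Graph.Edge static u w → ∃[ i ] T (delayed snapshots v i u w)
      static⇒output u w h with to (union u w) h
      ... | i , e with label⇒output {i = suc (toℕ i)} (i , refl , e)
      ...   | t , t<rounds , o , _ = fromℕ< t<rounds , subst (λ t → T (output t u w)) (sym (toℕ-fromℕ< t<rounds)) o

      output⇒static : ∀ u w → ∃[ i ] T (delayed snapshots v i u w) → Graph.Edge static u w
      output⇒static u w (i , o) with output⇒label (toℕ<n i) o
      ... | _ , (j , _ , e) , _ = from (union u w) (j , e)

    output⇒label′ : ∀ {t u w} → t < tmax + n → T (output t u w) → HasLabel G′ u w (suc t)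
    output⇒label′ {t} {u} {w} t<rounds o =
      fromℕ< t<rounds , cong suc (sym (toℕ-fromℕ< t<rounds)) , subst (λ t → T (output t u w)) (sym (toℕ-fromℕ< t<rounds)) o

    isDelaying : IsDelayingOf G G′
    isDelaying = delay , delay-symm , λ u w j → mk⇔
      (λ { (i , refl , o) → output⇒label (toℕ<n i) o })
      (λ { (i , l , refl) → delayed-label i l })
      where
      delayed-label : ∀ {u w} i → HasLabel G u w i → HasLabel G′ u w (i + delay u w i)
      delayed-label {u} {w} i l with label⇒output {i = i} l
      ... | t , t<rounds , o , eq = subst (HasLabel G′ u w) (sym eq) (output⇒label′ t<rounds o)

    -- The edge through which a vertex enters has a reached endpoint, so it is released in that very
    -- round. Its label `suc t` exceeds the arrival time at that endpoint.
    R⇒path : ∀ t {w} → t ≤ tmax + n → T (R t w) → ∃[ t′ ] (t′ ≤ t × TemporalPath G′ v w t′)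
    R⇒path zero {w} _ h = 0 , z≤n , subst (λ w → TemporalPath G′ v w 0) (singleton-≡ v w h) empty
    R⇒path (suc t) {w} t<rounds h with R-cases t h
    ... | inj₁ rw with R⇒path t (<⇒≤ t<rounds) rw
    ...   | t′ , t′≤t , path = t′ , m≤n⇒m≤1+n t′≤t , path
    R⇒path (suc t) {w} t<rounds h | inj₂ (u , q , ru) with R⇒path t (<⇒≤ t<rounds) ru
    ...   | t′ , t′≤t , path = suc t , ≤-refl , extend path (output⇒label′ t<rounds released-now) (s≤s t′≤t)
      where
      released-now : T (output t u w)
      released-now = subst T (sym (output-≡ t u w)) (from T-∧ (q , from T-∨ (inj₁ ru)))

    optimum : ℕ
    optimum = first allReached T₀

    optimum-least : ∀ t → T (allReached t) → optimum ≤ t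
    optimum-least t h with t ≤? T₀
    ... | yes t≤T₀ = proj₁ (proj₂ (first-least allReached T₀ t t≤T₀ h))
    -- Beyond the search bound the minimum is already at most `T₀`.
    ... | no t≰T₀  = ≤-trans (proj₁ (proj₂ (first-least allReached T₀ T₀ ≤-refl (allReached⁺ {T₀} all-in)))) (<⇒≤ (≰⇒> t≰T₀))

    optimum-lower : ∀ {G″ t} → IsDelayingOf G G″ → ReachesAllBy G″ v t → optimum ≤ t
    optimum-lower {t = t} D reaches = optimum-least t (allReached⁺ {t} λ w →
      let t′ , t′≤t , path = reaches w in R-mono t′≤t (path⇒R D path))

    reachtime : IsReachtime G′ v optimum
    reachtime = (λ w → R⇒path optimum (≤-trans (optimum-least T₀ (allReached⁺ {T₀} all-in)) (<⇒≤ T₀<rounds)) (allReached⁻ {optimum} (proj₁ least) w)) ,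
                -- `G′` is itself a delaying, so the general lower bound gives minimality of its own
                -- reaching time.
                λ t′ → optimum-lower isDelaying
      where least = first-least allReached T₀ T₀ ≤-refl (allReached⁺ {T₀} all-in)

    isOptimal : IsOptimalSolution G ⁅ v ⁆ G′
    isOptimal =
      (isDelaying , λ s s∈ w → subst (λ s → ∃[ t ] TemporalPath G′ s w t) (sym (x∈⁅y⁆⇒x≡y v s∈))
        (let t , _ , path = proj₁ reachtime w in t , path)) ,
      optimum ,
      ((λ s s∈ → optimum , subst (λ s → IsReachtime G′ s optimum) (sym (x∈⁅y⁆⇒x≡y v s∈)) reachtime , ≤-refl) ,
       v , x∈⁅x⁆ v , reachtime) ,
      λ G″ k″ (D , _) (_ , s , s∈ , reaches , _) →
        optimum-lower D (subst (λ s → ReachesAllBy G″ s k″) (x∈⁅y⁆⇒x≡y v s∈) reaches)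

theorem2 : Σ[ M ∈ TuringMachine ]
    PolyTimeSolves M {Instance}
    (λ (_ , G , v) → encodeInstance G v)
    (λ (_ , G , v) y →
    (∃[ G′ ] IsSolution G ⁅ v ⁆ G′) →
    ∃[ G′ ] (y ≡ encodeGraph G′ × IsOptimalSolution G ⁅ v ⁆ G′))
theorem2 = machine , 37 , 3 , λ (n , G , v) →
  let open Delaying G v in
  _ , _ , machine-computes snapshots v , runTime-polynomial snapshots v , λ (G″ , D , paths) →
    -- The snapshots of `G′` are by definition the matrices written by the machine, whence `refl`.
    -- The existence of a solution enters through `all-reached`.
    let open Connected (all-reached D (paths v (x∈⁅x⁆ v))) in G′ , refl , isOptimal
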